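{- Let $\Sigma$ be a circuit signature with value set $V$, let $(\mathcal I,\lVert-\rVert)$ be a complete interpretation of $\Sigma$, and let $\le$ be a total order on $V$. Then $$!\;=\;[\![-]\!]^{\mathbf S}_{\mathcal I}\circ\lVert-\rVert^{\le}_{\mathcal I},$$ i.e. for every initialised monotone $(V^m,V^n)$-Mealy machine $(S,f,s_0)$ (with $m,n\in\mathbb N$), the stream function computed by the machine equals the denotation of the circuit $\lVert (S,f,s_0)\rVert^{\le}_{\mathcal I}$ synthesised from it.
   Context: CIRCUITS. A circuit signature $\Sigma=(V,\bullet,P,\mathrm{dom},\mathrm{cod})$ consists of a finite set $V$ of values, an element $\bullet\in V$, a set $P$ of primitive symbols and functions $\mathrm{dom},\mathrm{cod}:P\to\mathbb N$. A PROP is a strict symmetric monoidal category with objects the natural numbers and tensor on objects given by addition. $\mathbf{CCirc}_\Sigma$ (combinational circuits) is the PROP freely generated by $p:\mathrm{dom}(p)\to\mathrm{cod}(p)$ ($p\in P$), $\bullet:0\to1$, fork $1\to2$, join $2\to1$, stub $1\to0$. $\mathbf{SCirc}_\Sigma$ (sequential circuits) is the symmetric traced PROP freely generated by the same generators together with $v:0\to1$ for each $v\in V\setminus\{\bullet\}$ and a delay $\delta:1\to1$. Combinational circuits are regarded as sequential ones. Composition in diagrammatic order is written $;$, and the trace is $\mathrm{Tr}^x:\mathrm{Hom}(x+m,x+n)\to\mathrm{Hom}(m,n)$. Multi-wire versions $\bullet_n$, $\mathrm{fork}_n:n\to 2n$, $\mathrm{join}_n:2n\to n$, $\mathrm{stub}_n$,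 $\delta_n$ act wirewise, and a word $\bar v\in V^n$ gives a circuit $\bar v:0\to n$ (tensor of its values). For $\bar v\in V^n$ the register is $\mathrm{reg}_{\bar v}:=(\bar v\otimes\delta_n);\mathrm{join}_n:n\to n$. INTERPRETATION AND DENOTATION. An interpretation $\mathcal I=(\sqsubseteq,[\![-]\!])$ of $\Sigma$ is a lattice order $\sqsubseteq$ on $V$ with least element $\bot=\bullet$ and, for each $p\in P$, a monotone function $[\![p]\!]:V^{\mathrm{dom}(p)}\to V^{\mathrm{cod}(p)}$ preserving the all-$\bot$ tuple. $\top$ is the greatest element of $V$. $(V^m)^\omega$ is the set of streams (functions $\mathbb N\to V^m$), ordered pointwise. The denotation $[\![F]\!]^{\mathbf S}_{\mathcal I}:(V^m)^\omega\to(V^n)^\omega$ of $F:m\to n$ in $\mathbf{SCirc}_\Sigma$ is defined compositionally: $p$ acts as $[\![p]\!]$ at each time index; fork is $v\mapsto(v,v)$, join is $(v,w)\mapsto v\sqcup w$, stub is $v\mapsto()$, each at every time index; $\bullet$ is the constant stream $\bot$; $v$ is the stream $v,\bot,\bot,\dots$; $\delta$ sends $\sigma$ to $\bot,\sigma(0),\sigma(1),\dots$; composition is function composition, tensor is product, and $\mathrm{Tr}^x(f)(\sigma)=\pi_1(f(\mu,\sigma))$ with $\mu$ the least fixed point of $\tau\mapsto\pi_0(f(\tau,\sigma))$. COMPLETE INTERPRETATION. For $\bar v\in V^k$ let $\bar v^{\infty}:=\mathrm{Tr}^k(\mathrm{reg}_{\bar v};\mathrm{fork}_k):0\to k$ (it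 emits $\bar v$ at every time). A complete interpretation is a pair $(\mathcal I,\lVert-\rVert)$ where $\lVert-\rVert$ sends each monotone $\bot$-preserving function $f:V^m\to V^n$ to a sequential circuit $\lVert f\rVert:m\to n$ of the form $(\bar v^{\infty}\otimes\mathrm{id}_m);G$, with $G:k+m\to n$ combinational and $\bar v\in V^k$, such that $[\![\lVert f\rVert]\!]^{\mathbf S}_{\mathcal I}(\sigma)(i)=f(\sigma(i))$. MEALY MACHINES. An initialised monotone $(V^m,V^n)$-Mealy machine is $(S,f,s_0)$ with $S$ a finite lattice with order $\preceq$, $s_0\in S$, and $f:S\times V^m\to S\times V^n$ monotone and $\bot$-preserving; write $f_0,f_1$ for the transition and output components. $!(S,f,s_0):(V^m)^\omega\to(V^n)^\omega$ sends $\sigma$ to the output stream $i\mapsto f_1(s_i,\sigma(i))$ where $s_{i+1}=f_0(s_i,\sigma(i))$. ENCODING. For a set $S$ with a partial order $\preceq$ and a total order $\le$, listed as $r_0\le r_1\le\dots\le r_{k-1}$, the $\le$-encoding $\gamma_\le:S\to V^k$ is $\gamma_\le(s)(i)=\top$ if $r_i\preceq s$ and $\bot$ otherwise. MONOTONE COMPLETION. For a finite poset $A$ contained in a finite lattice $B$, a finite lattice $C$ and a monotone $h:A\to C$, the monotone $B$-completion $h_{\mathsf m}:B\to C$ is defined recursively by $h_{\mathsf m}(b)=h(b)$ if $b\in A$; $h_{\mathsf m}(\bot_B)=\bot_C$ if $\bot_B\notin A$; otherwise $h_{\mathsf m}(b)=\bigvee\{h_{\mathsf m}(b')\mid b'\le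 b,\ b'\ne b\}$. MONOTONE MEALY ENCODING. For a monotone Mealy machine $(S,f,s_0)$ with $k$ states and an encoding $\gamma_\le:S\to V^k$, the monotone Mealy encoding $\gamma_\le(f):V^k\times V^m\to V^k\times V^n$ is the $(V^k\times V^m)$-completion of the function $\gamma_\le[S]\times V^m\to V^k\times V^n$, $(\gamma_\le(s),\bar x)\mapsto(\gamma_\le(f_0(s,\bar x)),f_1(s,\bar x))$. CHOSEN STATE ORDER. Given the total order $\le$ on $V$, extend it to a total order $\le_\star$ on the set $(V^m)^\star$ of finite words using the lexicographic order. Let $S'$ be the set of accessible states of $S$; for $s\in S'$ let $t_s$ be the minimal element of the set of words that transition from $s_0$ to $s$. The chosen state order on $S'$ is $s\le_{S'}s'$ iff $t_s\le_\star t_{s'}$. SYNTHESIS. With $\gamma_\le$ the encoding for the chosen state order determined by $\le$, and $k$ its width, $$\lVert(S,f,s_0)\rVert^{\le}_{\mathcal I}:=\mathrm{Tr}^k\big((\mathrm{reg}_{\gamma_\le(s_0)}\otimes\mathrm{id}_m);\lVert\gamma_\le(f)\rVert\big):m\to n.$$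
   Formalization: In the chosen state order, finite words are compared by length first and then lexicographically; under the plain lexicographic order the minimal word t_s need not exist (e.g. words ⊤ > ⊥⊤ > ⊥⊥⊤ > … reaching a latch's set state), so the circuit would be undefined. -}

module Defs where

open import Level using (0ℓ)
open import Data.Nat.Base as ℕ using (ℕ; zero; suc; _+_; _*_; z≤n; s≤s)
import Data.Nat.Properties as ℕ
open import Data.Nat.Induction using (<-wellFounded)
open import Data.Fin.Base as Fin using (Fin; toℕ)
import Data.Fin.Properties as Fin
open import Data.Fin.Induction using (po-wellFounded)
open import Data.Bool.Base using (if_then_else_)
open import Data.Maybe.Base using (Maybe; just; nothing)
open import Data.List.Base as List using (List; []; _∷_; length)
import Data.List.Properties as List
open import Data.List.Membership.Propositional using (_∈_; find; lose)
import Data.List.Membership.Propositional.Properties as ∈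
open import Data.List.Relation.Unary.Any as Any using (Any; here; there)
import Data.List.Relation.Unary.All as All
open import Data.List.Relation.Binary.Permutation.Propositional using (↭-sym)
open import Data.List.Relation.Binary.Permutation.Propositional.Properties using (∈-resp-↭)
import Data.List.Relation.Binary.Lex.NonStrict as ListLex
import Data.List.Sort as Sort
import Data.List.Extrema as Extrema
open import Data.Vec.Base as Vec using (Vec; []; _∷_; _++_; take; drop)
import Data.Vec.Properties as Vec
open import Data.Vec.Relation.Binary.Pointwise.Inductive as Pointwise using (Pointwise; []; _∷_)
import Data.Vec.Relation.Binary.Lex.NonStrict as VecLex
open import Data.Product.Base using (∃; _×_; _,_; proj₁; proj₂)
import Data.Product.Relation.Binary.Lex.NonStrict as ×Lex
open import Data.Product.Function.NonDependent.Propositional using (_×-↔_)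
open import Data.Sum.Base using (inj₁; inj₂; [_,_]′)
open import Function.Base using (_∘_; const)
open import Function.Bundles using (_↔_; Inverse; mk↔ₛ′)
open import Function.Construct.Composition using (_↔-∘_)
open import Function.Construct.Symmetry using (↔-sym)
open import Function.Properties.Inverse using (↔⇒↣)
open import Induction.WellFounded as WF using (WellFounded; Acc; acc)
open import Relation.Binary.Core using (Rel)
open import Relation.Binary.Bundles using (DecTotalOrder)
open import Relation.Binary.Definitions using (DecidableEquality)
import Relation.Binary.Definitions as Binary
open import Relation.Binary.Structures using (IsPartialOrder; IsTotalOrder)
open import Relation.Binary.Consequences using (total∧dec⇒dec)
import Relation.Binary.Construct.On as On
import Relation.Binary.Construct.NonStrictToStrict as ToStrict
open import Relation.Binary.Lattice.Bundles using (BoundedLattice)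
open import Relation.Binary.Lattice.Structures using (IsBoundedLattice)
import Relation.Binary.Lattice.Properties.JoinSemilattice as JoinSemilattice
open import Relation.Binary.PropositionalEquality
  using (_≡_; _≢_; refl; sym; trans; cong; cong₂; subst; subst₂; isEquivalence; module ≡-Reasoning)
open import Relation.Nullary using (Dec; yes; no; ¬_; contradiction)
open import Relation.Nullary.Decidable using (via-injection; ⌊_⌋; map′)
open import Relation.Unary using (Pred; Decidable)

-- A finite lattice with an element is bounded, and ⊤, ⊥, _⊔_, _⊓_ are all
-- determined by the order, so recording them adds no structure.
record FiniteLattice : Set₁ where
  infix 4 _⊑_ _⊏_
  infixr 6 _⊔_
  infixr 7 _⊓_
  field
    Carrier          : Set
    size             : ℕ
    finite           : Carrier ↔ Fin size
    _⊑_              : Rel Carrier 0ℓ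
    _⊔_ _⊓_          : Carrier → Carrier → Carrier
    ⊤ ⊥              : Carrier
    isBoundedLattice : IsBoundedLattice _≡_ _⊑_ _⊔_ _⊓_ ⊤ ⊥

  open IsBoundedLattice isBoundedLattice public
    using (isPartialOrder; maximum; minimum; supremum; infimum; x≤x∨y; y≤x∨y; ∨-least)
    renaming (refl to ⊑-refl; reflexive to ⊑-reflexive; trans to ⊑-trans; antisym to ⊑-antisym)

  boundedLattice : BoundedLattice 0ℓ 0ℓ 0ℓ
  boundedLattice = record { isBoundedLattice = isBoundedLattice }

  _⊏_ : Rel Carrier 0ℓ
  _⊏_ = ToStrict._<_ _≡_ _⊑_

  _≟_ : DecidableEquality Carrier
  _≟_ = via-injection (↔⇒↣ finite) Fin._≟_

  open JoinSemilattice (BoundedLattice.joinSemilattice boundedLattice) public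
    using (≈-dec⇒≤-dec) renaming (∨-monotonic to ⊔-mono)

  _⊑?_ : Binary.Decidable _⊑_
  _⊑?_ = ≈-dec⇒≤-dec _≟_

  _⊏?_ : Binary.Decidable _⊏_
  _⊏?_ = ToStrict.<-decidable _≡_ _⊑_ _≟_ _⊑?_

  elements : List Carrier
  elements = List.tabulate (Inverse.from finite)

  ∈-elements : ∀ x → x ∈ elements
  ∈-elements x =
    subst (_∈ elements) (Inverse.strictlyInverseʳ finite x) (∈.∈-tabulate⁺ (Inverse.to finite x))

  ⨆ : List Carrier → Carrier
  ⨆ = List.foldr _⊔_ ⊥

  ⨆-upper : ∀ {x} xs → x ∈ xs → x ⊑ ⨆ xs
  ⨆-upper (x ∷ xs) (here refl) = x≤x∨y x (⨆ xs)
  ⨆-upper (y ∷ xs) (there x∈xs) = ⊑-trans (⨆-upper xs x∈xs) (y≤x∨y y (⨆ xs))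

  ⨆-least : ∀ {y} xs → (∀ {x} → x ∈ xs → x ⊑ y) → ⨆ xs ⊑ y
  ⨆-least []       xs⊑y = minimum _
  ⨆-least (x ∷ xs) xs⊑y = ∨-least (xs⊑y (here refl)) (⨆-least xs (xs⊑y ∘ there))

  ⊏-wellFounded : WellFounded _⊏_
  ⊏-wellFounded =
    WF.Subrelation.wellFounded embed (On.wellFounded to (po-wellFounded isPartialOrder′))
    where
    open Inverse finite using (to; from; strictlyInverseʳ; strictlyInverseˡ)

    _⊑′_ : Rel (Fin size) 0ℓ
    i ⊑′ j = from i ⊑ from j

    from-injective : ∀ {i j} → from i ≡ from j → i ≡ j
    from-injective {i} {j} p =
      trans (sym (strictlyInverseˡ i)) (trans (cong to p) (strictlyInverseˡ j))

    isPartialOrder′ : IsPartialOrder _≡_ _⊑′_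
    isPartialOrder′ = record
      { isPreorder = record
        { isEquivalence = isEquivalence
        ; reflexive     = ⊑-reflexive ∘ cong from
        ; trans         = ⊑-trans
        }
      ; antisym = λ p q → from-injective (⊑-antisym p q)
      }

    embed : ∀ {x y} → x ⊏ y → ToStrict._<_ _≡_ _⊑′_ (to x) (to y)
    embed {x} {y} (x⊑y , x≢y) =
        subst₂ _⊑_ (sym (strictlyInverseʳ x)) (sym (strictlyInverseʳ y)) x⊑y
      , λ p → x≢y (trans (sym (strictlyInverseʳ x)) (trans (cong from p) (strictlyInverseʳ y)))

∣_∣ : FiniteLattice → Set
∣_∣ = FiniteLattice.Carrier

infixr 8 _^_
infixr 7 _⊠_

_^_ : FiniteLattice → ℕ → FiniteLattice
L ^ n = record
  { Carrier          = Vec ∣ L ∣ n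
  ; size             = size ℕ.^ n
  ; finite           = vec-finite n
  ; _⊑_              = Pointwise _⊑_
  ; _⊔_              = Vec.zipWith _⊔_
  ; _⊓_              = Vec.zipWith _⊓_
  ; ⊤                = Vec.replicate n ⊤
  ; ⊥                = Vec.replicate n ⊥
  ; isBoundedLattice = record
    { isLattice = record
      { isPartialOrder = record
        { isPreorder = record
          { isEquivalence = isEquivalence
          ; reflexive     = λ { refl → Pointwise.refl ⊑-refl }
          ; trans         = Pointwise.trans ⊑-trans
          }
        ; antisym = antisym
        }
      ; supremum = λ xs ys → upperˡ xs ys , upperʳ xs ys , λ _ → least
      ; infimum  = λ xs ys → lowerˡ xs ys , lowerʳ xs ys , λ _ → greatest
      }
    ; maximum = max
    ; minimum = min
    }
  }
  where
  open FiniteLattice L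

  vec-finite : ∀ n → Vec Carrier n ↔ Fin (size ℕ.^ n)
  vec-finite zero    = mk↔ₛ′ (λ _ → Fin.zero) (λ _ → []) (λ { Fin.zero → refl ; (Fin.suc ()) }) (λ { [] → refl })
  vec-finite (suc n) =
    ↔-sym Fin.*↔× ↔-∘ ((finite ×-↔ vec-finite n) ↔-∘
      mk↔ₛ′ Vec.uncons (λ (x , xs) → x ∷ xs) (λ _ → refl) (λ { (_ ∷ _) → refl }))

  antisym : ∀ {n} {xs ys : Vec Carrier n} → Pointwise _⊑_ xs ys → Pointwise _⊑_ ys xs → xs ≡ ys
  antisym []       []       = refl
  antisym (p ∷ ps) (q ∷ qs) = cong₂ _∷_ (⊑-antisym p q) (antisym ps qs)

  upperˡ : ∀ {n} (xs ys : Vec Carrier n) → Pointwise _⊑_ xs (Vec.zipWith _⊔_ xs ys)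
  upperˡ []       []       = []
  upperˡ (x ∷ xs) (y ∷ ys) = proj₁ (supremum x y) ∷ upperˡ xs ys

  upperʳ : ∀ {n} (xs ys : Vec Carrier n) → Pointwise _⊑_ ys (Vec.zipWith _⊔_ xs ys)
  upperʳ []       []       = []
  upperʳ (x ∷ xs) (y ∷ ys) = proj₁ (proj₂ (supremum x y)) ∷ upperʳ xs ys

  least : ∀ {n} {xs ys zs : Vec Carrier n} →
          Pointwise _⊑_ xs zs → Pointwise _⊑_ ys zs → Pointwise _⊑_ (Vec.zipWith _⊔_ xs ys) zs
  least []       []       = []
  least (p ∷ ps) (q ∷ qs) = proj₂ (proj₂ (supremum _ _)) _ p q ∷ least ps qs

  lowerˡ : ∀ {n} (xs ys : Vec Carrier n) → Pointwise _⊑_ (Vec.zipWith _⊓_ xs ys) xs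
  lowerˡ []       []       = []
  lowerˡ (x ∷ xs) (y ∷ ys) = proj₁ (infimum x y) ∷ lowerˡ xs ys

  lowerʳ : ∀ {n} (xs ys : Vec Carrier n) → Pointwise _⊑_ (Vec.zipWith _⊓_ xs ys) ys
  lowerʳ []       []       = []
  lowerʳ (x ∷ xs) (y ∷ ys) = proj₁ (proj₂ (infimum x y)) ∷ lowerʳ xs ys

  greatest : ∀ {n} {xs ys zs : Vec Carrier n} →
             Pointwise _⊑_ zs xs → Pointwise _⊑_ zs ys → Pointwise _⊑_ zs (Vec.zipWith _⊓_ xs ys)
  greatest []       []       = []
  greatest (p ∷ ps) (q ∷ qs) = proj₂ (proj₂ (infimum _ _)) _ p q ∷ greatest ps qs

  max : ∀ {n} (xs : Vec Carrier n) → Pointwise _⊑_ xs (Vec.replicate n ⊤)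
  max []       = []
  max (x ∷ xs) = maximum x ∷ max xs

  min : ∀ {n} (xs : Vec Carrier n) → Pointwise _⊑_ (Vec.replicate n ⊥) xs
  min []       = []
  min (x ∷ xs) = minimum x ∷ min xs

_⊠_ : FiniteLattice → FiniteLattice → FiniteLattice
K ⊠ L = record
  { Carrier          = ∣ K ∣ × ∣ L ∣
  ; size             = K.size * L.size
  ; finite           = ↔-sym Fin.*↔× ↔-∘ (K.finite ×-↔ L.finite)
  ; _⊑_              = λ (a , b) (c , d) → a K.⊑ c × b L.⊑ d
  ; _⊔_              = λ (a , b) (c , d) → a K.⊔ c , b L.⊔ d
  ; _⊓_              = λ (a , b) (c , d) → a K.⊓ c , b L.⊓ d
  ; ⊤                = K.⊤ , L.⊤
  ; ⊥                = K.⊥ , L.⊥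
  ; isBoundedLattice = record
    { isLattice = record
      { isPartialOrder = record
        { isPreorder = record
          { isEquivalence = isEquivalence
          ; reflexive     = λ { refl → K.⊑-refl , L.⊑-refl }
          ; trans         = λ (p , q) (p′ , q′) → K.⊑-trans p p′ , L.⊑-trans q q′
          }
        ; antisym = λ (p , q) (p′ , q′) → cong₂ _,_ (K.⊑-antisym p p′) (L.⊑-antisym q q′)
        }
      ; supremum = λ (a , b) (c , d) →
          let k₁ , k₂ , k₃ = K.supremum a c
              l₁ , l₂ , l₃ = L.supremum b d
          in (k₁ , l₁) , (k₂ , l₂) , λ _ (p , q) (p′ , q′) → k₃ _ p p′ , l₃ _ q q′
      ; infimum = λ (a , b) (c , d) →
          let k₁ , k₂ , k₃ = K.infimum a c
              l₁ , l₂ , l₃ = L.infimum b d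
          in (k₁ , l₁) , (k₂ , l₂) , λ _ (p , q) (p′ , q′) → k₃ _ p p′ , l₃ _ q q′
      }
    ; maximum = λ (a , b) → K.maximum a , L.maximum b
    ; minimum = λ (a , b) → K.minimum a , L.minimum b
    }
  }
  where
  module K = FiniteLattice K
  module L = FiniteLattice L

record MonotoneMap (K L : FiniteLattice) : Set where
  private
    module K = FiniteLattice K
    module L = FiniteLattice L
  field
    apply    : ∣ K ∣ → ∣ L ∣
    monotone : ∀ {x y} → x K.⊑ y → apply x L.⊑ apply y
    strict   : apply K.⊥ ≡ L.⊥

-- The subposet A of B is a decidable predicate and h b p is the value at b of
-- the map A → C; when h is monotone it does not depend on p.
module Completion (B C : FiniteLattice)
  (A : Pred ∣ B ∣ 0ℓ) (A? : Decidable A) (h : ∀ b → A b → ∣ C ∣) where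

  private
    module B = FiniteLattice B
    module C = FiniteLattice C

    at : ∀ {b b′} → Dec (b′ B.⊏ b) → (∀ {b′} → b′ B.⊏ b → ∣ C ∣) → Maybe ∣ C ∣
    at (yes b′⊏b) IH = just (IH b′⊏b)
    at (no  _)    IH = nothing

  valuesBelow : ∀ b → (∀ {b′} → b′ B.⊏ b → ∣ C ∣) → List ∣ C ∣
  valuesBelow b IH = List.mapMaybe (λ b′ → at (b′ B.⊏? b) IH) B.elements

  private
    choose : ∀ b → Dec (A b) → Dec (b ≡ B.⊥) → ∣ C ∣ → ∣ C ∣
    choose b (yes a) _       c = h b a
    choose b (no  _) (yes _) c = C.⊥
    choose b (no  _) (no  _) c = c

  step : ∀ b → (∀ {b′} → b′ B.⊏ b → ∣ C ∣) → ∣ C ∣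
  step b IH = choose b (A? b) (b B.≟ B.⊥) (C.⨆ (valuesBelow b IH))

  completion : ∣ B ∣ → ∣ C ∣
  completion = WF.All.wfRec B.⊏-wellFounded 0ℓ (const ∣ C ∣) step

  private
    step-ext : ∀ b {IH IH′ : ∀ {b′} → b′ B.⊏ b → ∣ C ∣} →
               (∀ {b′} (p : b′ B.⊏ b) → IH p ≡ IH′ p) → step b IH ≡ step b IH′
    step-ext b {IH} {IH′} eq =
      cong (choose b (A? b) (b B.≟ B.⊥) ∘ C.⨆) (List.mapMaybe-cong (λ b′ → at-ext (b′ B.⊏? b)) B.elements)
      where
      at-ext : ∀ {b′} (d : Dec (b′ B.⊏ b)) → at d IH ≡ at d IH′
      at-ext (yes p) = cong just (eq p)
      at-ext (no  _) = refl

  completion-unfold : ∀ b → completion b ≡ step b (λ {b′} _ → completion b′)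
  completion-unfold b =
    WF.FixPoint.unfold-wfRec B.⊏-wellFounded (const ∣ C ∣) step step-ext

  private
    below⁺ : ∀ {b b′} bs → b′ B.⊏ b → b′ ∈ bs →
             completion b′ ∈ List.mapMaybe (λ b′ → at (b′ B.⊏? b) (λ {x} _ → completion x)) bs
    below⁺ {b} {b′} (b″ ∷ bs) p (here refl) with b′ B.⊏? b
    ... | yes _  = here refl
    ... | no  ¬p = contradiction p ¬p
    below⁺ {b} (b″ ∷ bs) p (there q) with b″ B.⊏? b
    ... | yes _ = there (below⁺ bs p q)
    ... | no  _ = below⁺ bs p q

    below⁻ : ∀ {b c} bs → c ∈ List.mapMaybe (λ b′ → at (b′ B.⊏? b) (λ {x} _ → completion x)) bs →
             ∃ λ b′ → b′ B.⊏ b × c ≡ completion b′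
    below⁻ {b} (b″ ∷ bs) q with b″ B.⊏? b
    below⁻ {b} (b″ ∷ bs) (here refl) | yes p = b″ , p , refl
    below⁻ {b} (b″ ∷ bs) (there q)   | yes _ = below⁻ bs q
    below⁻ {b} (b″ ∷ bs) q           | no  _ = below⁻ bs q

    choose-upper : ∀ {x c} b d e → (∀ a → x C.⊑ h b a) → (b ≡ B.⊥ → x C.⊑ C.⊥) → x C.⊑ c →
                   x C.⊑ choose b d e c
    choose-upper b (yes a) _       p q r = p a
    choose-upper b (no  _) (yes e) p q r = q e
    choose-upper b (no  _) (no  _) p q r = r

    choose-lower : ∀ {x c} b d e → (∀ a → h b a C.⊑ x) → c C.⊑ x → choose b d e c C.⊑ x
    choose-lower b (yes a) _       p q = p a
    choose-lower b (no  _) (yes _) p q = C.minimum _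
    choose-lower b (no  _) (no  _) p q = q

  module _ (h-mono : ∀ {b b′} (p : A b) (q : A b′) → b B.⊑ b′ → h b p C.⊑ h b′ q) where

    completion-∈ : ∀ b (a : A b) → completion b ≡ h b a
    completion-∈ b a = trans (completion-unfold b) (lemma (A? b))
      where
      lemma : ∀ {e c} (d : Dec (A b)) → choose b d e c ≡ h b a
      lemma (yes a′) = C.⊑-antisym (h-mono a′ a B.⊑-refl) (h-mono a a′ B.⊑-refl)
      lemma (no ¬a)  = contradiction a ¬a

    completion-monotone : ∀ {b b′} → b B.⊑ b′ → completion b C.⊑ completion b′
    completion-monotone {b} = mono (B.⊏-wellFounded b)
      where
      mono : ∀ {b b′} → Acc B._⊏_ b → b B.⊑ b′ → completion b C.⊑ completion b′
      mono {b} {b′} (acc rs) b⊑b′ with b B.≟ b′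
      ... | yes refl = C.⊑-refl
      ... | no  b≢b′ = subst (completion b C.⊑_) (sym (completion-unfold b′))
        (choose-upper b′ (A? b′) (b′ B.≟ B.⊥)
          (λ a′ → subst (C._⊑ h b′ a′) (sym (completion-unfold b))
            (choose-lower b (A? b) (b B.≟ B.⊥)
              (λ a → h-mono a a′ b⊑b′)
              (C.⨆-least _ λ c∈ →
                let b″ , b″⊏b , c≡ = below⁻ B.elements c∈
                in subst₂ C._⊑_ (sym c≡) (completion-∈ b′ a′)
                     (mono (rs b″⊏b) (B.⊑-trans (proj₁ b″⊏b) b⊑b′)))))
          (λ { refl → contradiction (B.⊑-antisym b⊑b′ (B.minimum b)) b≢b′ })
          (C.⨆-upper _ (below⁺ B.elements (b⊑b′ , b≢b′) (B.∈-elements b))))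

  completion-strict : (∀ a → h B.⊥ a ≡ C.⊥) → completion B.⊥ ≡ C.⊥
  completion-strict h⊥ = trans (completion-unfold B.⊥) (lemma (A? B.⊥) (B.⊥ B.≟ B.⊥))
    where
    lemma : ∀ {c} (d : Dec (A B.⊥)) e → choose B.⊥ d e c ≡ C.⊥
    lemma (yes a) _         = h⊥ a
    lemma (no  _) (yes _)   = refl
    lemma (no  _) (no ⊥≢⊥) = contradiction refl ⊥≢⊥

Stream : Set → Set
Stream A = ℕ → A

module _ {L : FiniteLattice} where
  open FiniteLattice L

  infix 4 _⊑ˢ_

  _⊑ˢ_ : Rel (Stream ∣ L ∣) 0ℓ
  σ ⊑ˢ τ = ∀ i → σ i ⊑ τ i

  IsLeastFixedPoint : (Stream ∣ L ∣ → Stream ∣ L ∣) → Stream ∣ L ∣ → Set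
  IsLeastFixedPoint g μ = (∀ i → g μ i ≡ μ i) × (∀ τ → (∀ i → g τ i ≡ τ i) → μ ⊑ˢ τ)

-- Denotations of circuits carry the proof of monotonicity and causality that
-- the existence of the least fixed point in the trace relies on.
record StreamFunction (K L : FiniteLattice) : Set where
  private
    module K = FiniteLattice K
    module L = FiniteLattice L
  field
    apply    : Stream ∣ K ∣ → Stream ∣ L ∣
    monotone : ∀ {σ τ} → _⊑ˢ_ {K} σ τ → _⊑ˢ_ {L} (apply σ) (apply τ)
    causal   : ∀ {σ τ} i → (∀ j → j ℕ.≤ i → σ j ≡ τ j) → apply σ i ≡ apply τ i

-- The i-th entry of the Kleene chain of a causal monotone g is stationary from
-- stage (i + 1) · |L| on: each entry takes at most |L| further stages to settle
-- once the earlier ones have.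
module Kleene {L : FiniteLattice} where
  open FiniteLattice L

  iterate : (Stream ∣ L ∣ → Stream ∣ L ∣) → ℕ → Stream ∣ L ∣
  iterate g zero    = λ _ → ⊥
  iterate g (suc n) = g (iterate g n)

  lfp : (Stream ∣ L ∣ → Stream ∣ L ∣) → Stream ∣ L ∣
  lfp g i = iterate g (suc i * size) i

  iterate-mono : ∀ {g g′} → (∀ {σ τ} → _⊑ˢ_ {L} σ τ → _⊑ˢ_ {L} (g σ) (g′ τ)) →
                 ∀ n → _⊑ˢ_ {L} (iterate g n) (iterate g′ n)
  iterate-mono g⊑g′ zero    = λ _ → ⊑-refl
  iterate-mono g⊑g′ (suc n) = g⊑g′ (iterate-mono g⊑g′ n)

  iterate-causal : ∀ {g g′} i →
    (∀ {σ τ} j → j ℕ.≤ i → (∀ k → k ℕ.≤ j → σ k ≡ τ k) → g σ j ≡ g′ τ j) →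
    ∀ n j → j ℕ.≤ i → iterate g n j ≡ iterate g′ n j
  iterate-causal i g≡g′ zero    j j≤i = refl
  iterate-causal i g≡g′ (suc n) j j≤i =
    g≡g′ j j≤i (λ k k≤j → iterate-causal i g≡g′ n k (ℕ.≤-trans k≤j j≤i))

  module _ (G : StreamFunction L L) where
    open StreamFunction G renaming (apply to g)

    private
      c : ℕ → Stream ∣ L ∣
      c = iterate g

      c-step : ∀ n → _⊑ˢ_ {L} (c n) (c (suc n))
      c-step zero    = λ _ → minimum _
      c-step (suc n) = monotone (c-step n)

      c-mono : ∀ {m n} → m ℕ.≤ n → _⊑ˢ_ {L} (c m) (c n)
      c-mono m≤n = go (ℕ.≤⇒≤′ m≤n)
        where
        go : ∀ {m n} → m ℕ.≤′ n → _⊑ˢ_ {L} (c m) (c n)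
        go ℕ.≤′-refl     i = ⊑-refl
        go (ℕ.≤′-step {n} p) i = ⊑-trans (go p i) (c-step n i)

      Stable : ℕ → ℕ → Set
      Stable N i = ∀ n → N ℕ.≤ n → c n i ≡ c N i

      weaken : ∀ {N N′ i} → N ℕ.≤ N′ → Stable N i → Stable N′ i
      weaken N≤N′ st n N′≤n = trans (st n (ℕ.≤-trans N≤N′ N′≤n)) (sym (st _ N≤N′))

      settle : ∀ N i → (∀ j → j ℕ.< i → Stable N j) → Stable (N + size) i
      settle N i earlier with Fin.pigeonhole (ℕ.n<1+n size) (λ a → Inverse.to finite (c (N + toℕ a) i))
      ... | a , b , a<b , ca≡cb =
        weaken (ℕ.+-monoʳ-≤ N (ℕ.≤-pred (Fin.toℕ<n a))) (λ n p →
          let d , eq = ℕ.m≤n⇒∃[o]m+o≡n p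
          in trans (cong (λ k → c k i) (trans (sym eq) (ℕ.+-comm _ d))) (stays d))
        where
        M : ℕ
        M = N + toℕ a

        same : c M i ≡ c (N + toℕ b) i
        same = trans (sym (Inverse.strictlyInverseʳ finite _))
                 (trans (cong (Inverse.from finite) ca≡cb) (Inverse.strictlyInverseʳ finite _))

        first : c M i ≡ c (suc M) i
        first = ⊑-antisym (c-step M i)
          (⊑-trans (c-mono (ℕ.≤-trans (ℕ.≤-reflexive (sym (ℕ.+-suc N (toℕ a)))) (ℕ.+-monoʳ-≤ N a<b)) i)
                   (⊑-reflexive (sym same)))

        next : ∀ n → N ℕ.≤ n → c n i ≡ c (suc n) i → c (suc n) i ≡ c (suc (suc n)) i
        next n N≤n eq = causal i λ j j≤i → [ (λ j<i → trans (earlier j j<i n N≤n)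
                                                (sym (earlier j j<i (suc n) (ℕ.m≤n⇒m≤1+n N≤n))))
                                           , (λ { refl → eq }) ]′ (ℕ.m≤n⇒m<n∨m≡n j≤i)

        steps : ∀ d → c (d + M) i ≡ c (suc (d + M)) i
        steps zero    = first
        steps (suc d) = next (d + M) (ℕ.≤-trans (ℕ.m≤m+n N (toℕ a)) (ℕ.m≤n+m M d)) (steps d)

        stays : ∀ d → c (d + M) i ≡ c M i
        stays zero    = refl
        stays (suc d) = trans (sym (steps d)) (stays d)

      stable< : ∀ i j → j ℕ.< i → Stable (i * size) j
      stable< (suc i) j (s≤s j≤i) =
        [ (λ j<i → weaken (ℕ.m≤n+m (i * size) size) (stable< i j j<i))
        , (λ { refl → subst (λ N → Stable N j) (ℕ.+-comm (i * size) size) (settle (i * size) i (stable< i)) })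
        ]′ (ℕ.m≤n⇒m<n∨m≡n j≤i)

      stable : ∀ i → Stable (suc i * size) i
      stable i = stable< (suc i) i ℕ.≤-refl

    lfp-fixed : ∀ i → g (lfp g) i ≡ lfp g i
    lfp-fixed i = trans
      (causal i λ j j≤i → sym (stable j (suc i * size) (ℕ.*-monoˡ-≤ size (s≤s j≤i))))
      (stable i (suc (suc i * size)) (ℕ.n≤1+n _))

    lfp-least : ∀ τ → _⊑ˢ_ {L} (g τ) τ → _⊑ˢ_ {L} (lfp g) τ
    lfp-least τ gτ⊑τ i = below (suc i * size) i
      where
      below : ∀ n → _⊑ˢ_ {L} (c n) τ
      below zero    = λ _ → minimum _
      below (suc n) = λ i → ⊑-trans (monotone {iterate g n} (below n) i) (gτ⊑τ i)

    lfp-isLeastFixedPoint : IsLeastFixedPoint {L} g (lfp g)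
    lfp-isLeastFixedPoint = lfp-fixed , λ τ gτ≡τ → lfp-least τ (⊑-reflexive ∘ gτ≡τ)

record Signature : Set₁ where
  field
    V       : Set
    card    : ℕ
    finite  : V ↔ Fin card
    •       : V
    P       : Set
    dom cod : P → ℕ

  _≟ⱽ_ : DecidableEquality V
  _≟ⱽ_ = via-injection (↔⇒↣ finite) Fin._≟_

data Kind : Set where
  combinational sequential : Kind

module _ (Sg : Signature) where
  open Signature Sg

  data Generator : Kind → ℕ → ℕ → Set where
    prim  : ∀ {κ} (p : P) → Generator κ (dom p) (cod p)
    blank : ∀ {κ} → Generator κ 0 1
    fork  : ∀ {κ} → Generator κ 1 2
    join  : ∀ {κ} → Generator κ 2 1
    stub  : ∀ {κ} → Generator κ 1 0
    value : (v : V) → v ≢ • → Generator sequential 0 1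
    delay : Generator sequential 1 1

  infixl 5 _⨾_
  infixr 6 _⊗_

  -- Representatives of the morphisms of the free (traced) PROP; equality of
  -- morphisms is _≈_ below.
  data Circuit : Kind → ℕ → ℕ → Set where
    gen  : ∀ {κ m n} → Generator κ m n → Circuit κ m n
    id   : ∀ {κ} n → Circuit κ n n
    _⨾_  : ∀ {κ m n p} → Circuit κ m n → Circuit κ n p → Circuit κ m p
    _⊗_  : ∀ {κ m n p q} → Circuit κ m n → Circuit κ p q → Circuit κ (m + p) (n + q)
    swap : ∀ {κ} m n → Circuit κ (m + n) (n + m)
    Tr   : ∀ x {m n} → Circuit sequential (x + m) (x + n) → Circuit sequential m n

  CCirc SCirc : ℕ → ℕ → Set
  CCirc = Circuit combinational
  SCirc = Circuit sequential

module _ {Sg : Signature} where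
  open Signature Sg

  -- The identity between objects that are equal, but not definitionally so.
  coe : ∀ {κ m n} → m ≡ n → Circuit Sg κ m n
  coe {m = m} refl = id m

  infix 4 _≈_

  data _≈_ : ∀ {κ m n} → Circuit Sg κ m n → Circuit Sg κ m n → Set where
    ≈-refl  : ∀ {κ m n} {f : Circuit Sg κ m n} → f ≈ f
    ≈-sym   : ∀ {κ m n} {f g : Circuit Sg κ m n} → f ≈ g → g ≈ f
    ≈-trans : ∀ {κ m n} {f g h : Circuit Sg κ m n} → f ≈ g → g ≈ h → f ≈ h

    ⨾-cong  : ∀ {κ m n p} {f f′ : Circuit Sg κ m n} {g g′ : Circuit Sg κ n p} →
              f ≈ f′ → g ≈ g′ → f ⨾ g ≈ f′ ⨾ g′
    ⊗-cong  : ∀ {κ m n p q} {f f′ : Circuit Sg κ m n} {g g′ : Circuit Sg κ p q} →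
              f ≈ f′ → g ≈ g′ → f ⊗ g ≈ f′ ⊗ g′
    Tr-cong : ∀ {x m n} {f f′ : SCirc Sg (x + m) (x + n)} → f ≈ f′ → Tr x f ≈ Tr x f′

    ⨾-identityˡ : ∀ {κ m n} {f : Circuit Sg κ m n} → id m ⨾ f ≈ f
    ⨾-identityʳ : ∀ {κ m n} {f : Circuit Sg κ m n} → f ⨾ id n ≈ f
    ⨾-assoc     : ∀ {κ m n p q} {f : Circuit Sg κ m n} {g : Circuit Sg κ n p} {h : Circuit Sg κ p q} →
                  (f ⨾ g) ⨾ h ≈ f ⨾ (g ⨾ h)

    ⊗-id        : ∀ {κ m n} → id {κ = κ} m ⊗ id n ≈ id (m + n)
    ⊗-⨾         : ∀ {κ m n p m′ n′ p′}
                  {f : Circuit Sg κ m n} {g : Circuit Sg κ n p}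
                  {f′ : Circuit Sg κ m′ n′} {g′ : Circuit Sg κ n′ p′} →
                  (f ⨾ g) ⊗ (f′ ⨾ g′) ≈ (f ⊗ f′) ⨾ (g ⊗ g′)
    ⊗-identityˡ : ∀ {κ m n} {f : Circuit Sg κ m n} → id 0 ⊗ f ≈ f
    ⊗-identityʳ : ∀ {κ m n} {f : Circuit Sg κ m n} →
                  (f ⊗ id 0) ⨾ coe (ℕ.+-identityʳ n) ≈ coe (ℕ.+-identityʳ m) ⨾ f
    ⊗-assoc     : ∀ {κ m n m′ n′ m″ n″}
                  {f : Circuit Sg κ m n} {g : Circuit Sg κ m′ n′} {h : Circuit Sg κ m″ n″} →
                  ((f ⊗ g) ⊗ h) ⨾ coe (ℕ.+-assoc n n′ n″) ≈ coe (ℕ.+-assoc m m′ m″) ⨾ (f ⊗ (g ⊗ h))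

    swap-natural    : ∀ {κ m n m′ n′} {f : Circuit Sg κ m n} {g : Circuit Sg κ m′ n′} →
                      (f ⊗ g) ⨾ swap n n′ ≈ swap m m′ ⨾ (g ⊗ f)
    swap-involutive : ∀ {κ m n} → swap {κ = κ} m n ⨾ swap n m ≈ id (m + n)
    swap-hexagon    : ∀ {κ m n p} →
                      swap {κ = κ} m (n + p) ≈
                        coe (sym (ℕ.+-assoc m n p)) ⨾ (swap m n ⊗ id p) ⨾
                        coe (ℕ.+-assoc n m p) ⨾ (id n ⊗ swap m p) ⨾ coe (sym (ℕ.+-assoc n p m))

    Tr-natural   : ∀ {x m n m′ n′} {f : SCirc Sg (x + m) (x + n)} {g : SCirc Sg m′ m} {h : SCirc Sg n n′} →
                   Tr x ((id x ⊗ g) ⨾ f ⨾ (id x ⊗ h)) ≈ g ⨾ Tr x f ⨾ h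
    Tr-sliding   : ∀ {x y m n} {f : SCirc Sg (x + m) (y + n)} {u : SCirc Sg y x} →
                   Tr x (f ⨾ (u ⊗ id n)) ≈ Tr y ((u ⊗ id m) ⨾ f)
    Tr-vanishing₀ : ∀ {m n} {f : SCirc Sg m n} → Tr 0 f ≈ f
    Tr-vanishing₊ : ∀ {x y m n} {f : SCirc Sg ((x + y) + m) ((x + y) + n)} →
                   Tr (x + y) f ≈
                   Tr y (Tr x (coe (sym (ℕ.+-assoc x y m)) ⨾ f ⨾ coe (ℕ.+-assoc x y n)))
    Tr-superposing : ∀ {x m n p q} {f : SCirc Sg (x + m) (x + n)} {g : SCirc Sg p q} →
                   Tr x f ⊗ g ≈
                   Tr x (coe (sym (ℕ.+-assoc x m p)) ⨾ (f ⊗ g) ⨾ coe (ℕ.+-assoc x n q))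
    Tr-yanking   : ∀ {x} → Tr x (swap x x) ≈ id x

  sequentially : ∀ {m n} → CCirc Sg m n → SCirc Sg m n
  sequentially (gen (prim p)) = gen (prim p)
  sequentially (gen blank)    = gen blank
  sequentially (gen fork)     = gen fork
  sequentially (gen join)     = gen join
  sequentially (gen stub)     = gen stub
  sequentially (id n)         = id n
  sequentially (F ⨾ G)        = sequentially F ⨾ sequentially G
  sequentially (F ⊗ G)        = sequentially F ⊗ sequentially G
  sequentially (swap m n)     = swap m n

  -- (1 + a) + (1 + b) wires to (1 + 1) + (a + b), bringing the two heads together.
  unzip : ∀ a b → SCirc Sg (suc a + suc b) (2 + (a + b))
  unzip a b = id 1 ⊗ (coe (sym (ℕ.+-assoc a 1 b)) ⨾ (swap a 1 ⊗ id b))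

  zip : ∀ a b → SCirc Sg (2 + (a + b)) (suc a + suc b)
  zip a b = id 1 ⊗ ((swap 1 a ⊗ id b) ⨾ coe (ℕ.+-assoc a 1 b))

  fork[_] : ∀ n → SCirc Sg n (n + n)
  fork[ zero  ] = id 0
  fork[ suc n ] = (gen fork ⊗ fork[ n ]) ⨾ zip n n

  join[_] : ∀ n → SCirc Sg (n + n) n
  join[ zero  ] = id 0
  join[ suc n ] = unzip n n ⨾ (gen join ⊗ join[ n ])

  delay[_] : ∀ n → SCirc Sg n n
  delay[ zero  ] = id 0
  delay[ suc n ] = gen delay ⊗ delay[ n ]

  emit : V → SCirc Sg 0 1
  emit v with v ≟ⱽ •
  ... | yes _  = gen blank
  ... | no v≢• = gen (value v v≢•)

  word : ∀ {n} → Vec V n → SCirc Sg 0 n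
  word []       = id 0
  word (v ∷ vs) = emit v ⊗ word vs

  reg : ∀ {n} → Vec V n → SCirc Sg n n
  reg {n} vs = (word vs ⊗ delay[ n ]) ⨾ join[ n ]

  infix 9 _^∞

  _^∞ : ∀ {k} → Vec V k → SCirc Sg 0 k
  _^∞ {k} vs = Tr k (coe (ℕ.+-identityʳ k) ⨾ reg vs ⨾ fork[ k ])

module _ {L : FiniteLattice} where
  open FiniteLattice L

  take-mono : ∀ m {n} {xs ys : Vec ∣ L ∣ (m + n)} → Pointwise _⊑_ xs ys → Pointwise _⊑_ (take m xs) (take m ys)
  take-mono zero    ps       = []
  take-mono (suc m) {xs = _ ∷ _} {ys = _ ∷ _} (p ∷ ps) = p ∷ take-mono m ps

  drop-mono : ∀ m {n} {xs ys : Vec ∣ L ∣ (m + n)} → Pointwise _⊑_ xs ys → Pointwise _⊑_ (drop m xs) (drop m ys)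
  drop-mono zero    ps       = ps
  drop-mono (suc m) {xs = _ ∷ _} {ys = _ ∷ _} (p ∷ ps) = drop-mono m ps

record Interpretation (Sg : Signature) : Set₁ where
  open Signature Sg
  field
    _⊑_              : Rel V 0ℓ
    _⊔_ _⊓_          : V → V → V
    ⊤                : V
    isBoundedLattice : IsBoundedLattice _≡_ _⊑_ _⊔_ _⊓_ ⊤ •

  values : FiniteLattice
  values = record { finite = finite ; isBoundedLattice = isBoundedLattice }

  field
    ⟦_⟧ₚ : ∀ p → MonotoneMap (values ^ dom p) (values ^ cod p)

module _ {Sg : Signature} (I : Interpretation Sg) where
  open Signature Sg
  open Interpretation I
  open FiniteLattice values using (⊑-refl; ⊔-mono)
  open StreamFunction

  private
    Fn : ℕ → ℕ → Set
    Fn m n = StreamFunction (values ^ m) (values ^ n)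

    pointwise : ∀ {m n} (f : Vec V m → Vec V n) →
                (∀ {xs ys} → Pointwise _⊑_ xs ys → Pointwise _⊑_ (f xs) (f ys)) → Fn m n
    pointwise f f-mono = record
      { apply    = λ σ i → f (σ i)
      ; monotone = λ σ⊑τ i → f-mono (σ⊑τ i)
      ; causal   = λ i σ≡τ → cong f (σ≡τ i ℕ.≤-refl)
      }

  initially : V → Stream (Vec V 1)
  initially v zero    = v ∷ []
  initially v (suc i) = • ∷ []

  delayed : Stream (Vec V 1) → Stream (Vec V 1)
  delayed σ zero    = • ∷ []
  delayed σ (suc i) = σ i

  generatorᴰ : ∀ {m n} → Generator Sg sequential m n → Fn m n
  generatorᴰ (prim p) = pointwise (MonotoneMap.apply ⟦ p ⟧ₚ) (MonotoneMap.monotone ⟦ p ⟧ₚ)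
  generatorᴰ blank    = pointwise (λ _ → • ∷ []) (λ _ → ⊑-refl ∷ [])
  generatorᴰ fork     = pointwise (λ { (v ∷ []) → v ∷ v ∷ [] }) (λ { (p ∷ []) → p ∷ p ∷ [] })
  generatorᴰ join     = pointwise (λ { (v ∷ w ∷ []) → v ⊔ w ∷ [] }) (λ { (p ∷ q ∷ []) → ⊔-mono p q ∷ [] })
  generatorᴰ stub     = pointwise (λ _ → []) (λ _ → [])
  generatorᴰ (value v _) = record
    { apply    = λ _ → initially v
    ; monotone = λ _ _ → Pointwise.refl ⊑-refl
    ; causal   = λ _ _ → refl
    }
  generatorᴰ delay = record
    { apply    = delayed
    ; monotone = λ { σ⊑τ zero → ⊑-refl ∷ [] ; σ⊑τ (suc i) → σ⊑τ i }
    ; causal   = λ { zero σ≡τ → refl ; (suc i) σ≡τ → σ≡τ i (ℕ.n≤1+n i) }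
    }

  composeᴰ : ∀ {m n p} → Fn m n → Fn n p → Fn m p
  composeᴰ f g = record
    { apply    = apply g ∘ apply f
    ; monotone = monotone g ∘ monotone f
    ; causal   = λ i σ≡τ → causal g i λ j j≤i → causal f j λ k k≤j → σ≡τ k (ℕ.≤-trans k≤j j≤i)
    }

  tensorᴰ : ∀ {m n p q} → Fn m n → Fn p q → Fn (m + p) (n + q)
  tensorᴰ {m} f g = record
    { apply    = λ σ i → apply f (take m ∘ σ) i ++ apply g (drop m ∘ σ) i
    ; monotone = λ σ⊑τ i → Pointwise.++⁺ (monotone f (take-mono {values} m ∘ σ⊑τ) i)
                                         (monotone g (drop-mono {values} m ∘ σ⊑τ) i)
    ; causal   = λ i σ≡τ → cong₂ _++_ (causal f i λ j j≤i → cong (take m) (σ≡τ j j≤i))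
                                      (causal g i λ j j≤i → cong (drop m) (σ≡τ j j≤i))
    }

  feedback : ∀ x {m n} → Fn (x + m) (x + n) → Stream (Vec V m) → Fn x x
  feedback x f σ = record
    { apply    = λ τ i → take x (apply f (λ j → τ j ++ σ j) i)
    ; monotone = λ τ⊑τ′ i → take-mono {values} x
                   (monotone f (λ j → Pointwise.++⁺ (τ⊑τ′ j) (Pointwise.refl ⊑-refl)) i)
    ; causal   = λ i τ≡τ′ → cong (take x) (causal f i λ j j≤i → cong (_++ σ j) (τ≡τ′ j j≤i))
    }

  leastFeedback : ∀ x {m n} → Fn (x + m) (x + n) → Stream (Vec V m) → Stream (Vec V x)
  leastFeedback x f σ = Kleene.lfp {values ^ x} (apply (feedback x f σ))

  leastFeedback-isLeastFixedPoint : ∀ x {m n} (f : Fn (x + m) (x + n)) σ →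
    IsLeastFixedPoint {values ^ x} (apply (feedback x f σ)) (leastFeedback x f σ)
  leastFeedback-isLeastFixedPoint x f σ = Kleene.lfp-isLeastFixedPoint (feedback x f σ)

  traceᴰ : ∀ x {m n} → Fn (x + m) (x + n) → Fn m n
  traceᴰ x f = record
    { apply    = λ σ i → drop x (apply f (λ j → leastFeedback x f σ j ++ σ j) i)
    ; monotone = λ σ⊑τ i → drop-mono {values} x (monotone f (λ j → Pointwise.++⁺
        (Kleene.iterate-mono {values ^ x}
          (λ ρ⊑ρ′ k → take-mono {values} x (monotone f (λ l → Pointwise.++⁺ (ρ⊑ρ′ l) (σ⊑τ l)) k))
          (suc j * FiniteLattice.size (values ^ x)) j)
        (σ⊑τ j)) i)
    ; causal   = λ i σ≡τ → cong (drop x) (causal f i λ j j≤i → cong₂ _++_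
        (Kleene.iterate-causal {values ^ x} i
          (λ k k≤i ρ≡ρ′ → cong (take x) (causal f k λ l l≤k →
            cong₂ _++_ (ρ≡ρ′ l l≤k) (σ≡τ l (ℕ.≤-trans l≤k k≤i))))
          (suc j * FiniteLattice.size (values ^ x)) j j≤i)
        (σ≡τ j j≤i))
    }

  denotation : ∀ {m n} → SCirc Sg m n → Fn m n
  denotation (gen g)    = generatorᴰ g
  denotation (id n)     = pointwise (λ xs → xs) (λ p → p)
  denotation (F ⨾ G)    = composeᴰ (denotation F) (denotation G)
  denotation (F ⊗ G)    = tensorᴰ (denotation F) (denotation G)
  denotation (swap m n) = pointwise (λ xs → drop m xs ++ take m xs)
                            (λ p → Pointwise.++⁺ (drop-mono {values} m p) (take-mono {values} m p))
  denotation (Tr x F)   = traceᴰ x (denotation F)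

  ⟦_⟧ : ∀ {m n} → SCirc Sg m n → Stream (Vec V m) → Stream (Vec V n)
  ⟦ F ⟧ = apply (denotation F)

private
  module _ {A : Set} where
    take-++ : ∀ {m n} (xs : Vec A m) {ys : Vec A n} → take m (xs ++ ys) ≡ xs
    take-++ []       = refl
    take-++ (x ∷ xs) = cong (x ∷_) (take-++ xs)

    drop-++ : ∀ {m n} (xs : Vec A m) {ys : Vec A n} → drop m (xs ++ ys) ≡ ys
    drop-++ []       = refl
    drop-++ (x ∷ xs) = drop-++ xs

    empty : (xs : Vec A 0) → [] ≡ xs
    empty [] = refl

    module _ (a b : ℕ) {c : ℕ} where
      take-assoc : (zs : Vec A ((a + b) + c)) →
                   take a (take (a + b) zs) ≡ take a (Vec.cast (ℕ.+-assoc a b c) zs)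
      take-assoc = go a
        where
        go : ∀ a (zs : Vec A ((a + b) + c)) →
             take a (take (a + b) zs) ≡ take a (Vec.cast (ℕ.+-assoc a b c) zs)
        go zero    zs       = refl
        go (suc a) (z ∷ zs) = cong (z ∷_) (go a zs)

      mid-assoc : (zs : Vec A ((a + b) + c)) →
                  drop a (take (a + b) zs) ≡ take b (drop a (Vec.cast (ℕ.+-assoc a b c) zs))
      mid-assoc = go a
        where
        go : ∀ a (zs : Vec A ((a + b) + c)) →
             drop a (take (a + b) zs) ≡ take b (drop a (Vec.cast (ℕ.+-assoc a b c) zs))
        go zero    zs       = cong (take b) (sym (Vec.cast-is-id refl zs))
        go (suc a) (z ∷ zs) = go a zs

      drop-assoc : (zs : Vec A ((a + b) + c)) →
                   drop (a + b) zs ≡ drop b (drop a (Vec.cast (ℕ.+-assoc a b c) zs))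
      drop-assoc = go a
        where
        go : ∀ a (zs : Vec A ((a + b) + c)) →
             drop (a + b) zs ≡ drop b (drop a (Vec.cast (ℕ.+-assoc a b c) zs))
        go zero    zs       = cong (drop b) (sym (Vec.cast-is-id refl zs))
        go (suc a) (z ∷ zs) = go a zs

-- The denotation respects _≈_, i.e. is defined on the morphisms of the PROP.
module Soundness {Sg : Signature} (I : Interpretation Sg) where
  open Signature Sg using (V)
  open Interpretation I using (values)
  open StreamFunction
  open FiniteLattice using (⊑-antisym; ⊑-refl; ⊑-reflexive; ⊑-trans; size)

  private
    Fn : ℕ → ℕ → Set
    Fn m n = StreamFunction (values ^ m) (values ^ n)

    Str : ℕ → Set
    Str n = Stream (Vec V n)

    infix 4 _≗ˢ_
    _≗ˢ_ : ∀ {n} → Rel (Str n) 0ℓ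
    σ ≗ˢ τ = ∀ i → σ i ≡ τ i

    infix 4 _≤ˢ_
    _≤ˢ_ : ∀ {n} → Rel (Str n) 0ℓ
    _≤ˢ_ {n} = _⊑ˢ_ {values ^ n}

    app-cong : ∀ {m n} (f : Fn m n) {σ τ} → σ ≗ˢ τ → apply f σ ≗ˢ apply f τ
    app-cong f σ≗τ i = causal f i λ j _ → σ≗τ j

    infixr 5 _⧺_
    _⧺_ : ∀ {m n} → Str m → Str n → Str (m + n)
    (σ ⧺ τ) i = σ i ++ τ i

    ⧺-cong : ∀ {m n} {σ σ′ : Str m} {τ τ′ : Str n} → σ ≗ˢ σ′ → τ ≗ˢ τ′ → σ ⧺ τ ≗ˢ σ′ ⧺ τ′
    ⧺-cong p q i = cong₂ _++_ (p i) (q i)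

    lfp : ∀ {x} → (Str x → Str x) → Str x
    lfp {x} = Kleene.lfp {values ^ x}

    lfp-ext : ∀ {x} (g g′ : Fn x x) → (∀ τ → apply g τ ≗ˢ apply g′ τ) → lfp (apply g) ≗ˢ lfp (apply g′)
    lfp-ext {x} g g′ eq i = Kleene.iterate-causal {values ^ x} i
      (λ {σ} {τ} j _ σ≡τ → trans (causal g j σ≡τ) (eq τ j)) (suc i * size (values ^ x)) i ℕ.≤-refl

    fixed : ∀ {x} (g : Fn x x) → apply g (lfp (apply g)) ≗ˢ lfp (apply g)
    fixed {x} g = Kleene.lfp-fixed {values ^ x} g

    least : ∀ {x} (g : Fn x x) τ → apply g τ ≤ˢ τ → lfp (apply g) ≤ˢ τ
    least {x} g = Kleene.lfp-least {values ^ x} g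

    leastᶠ : ∀ {x} (g : Fn x x) τ → apply g τ ≗ˢ τ → lfp (apply g) ≤ˢ τ
    leastᶠ {x} g τ eq = least g τ (λ i → ⊑-reflexive (values ^ x) (eq i))

    antisymˢ : ∀ {x} {σ τ : Str x} → σ ≤ˢ τ → τ ≤ˢ σ → σ ≗ˢ τ
    antisymˢ {x} p q i = ⊑-antisym (values ^ x) (p i) (q i)

    rolling : ∀ {x y} (a : Fn x y) (b : Fn y x) →
              apply b (lfp (apply (composeᴰ I b a))) ≗ˢ lfp (apply (composeᴰ I a b))
    rolling {x} {y} a b i = trans (app-cong b (λ j → sym (aμ≗ν j)) i) (fixed ab i)
      where
      ab = composeᴰ I a b
      ba = composeᴰ I b a
      μ = lfp (apply ab)
      ν = lfp (apply ba)

      ν≤aμ : ν ≤ˢ apply a μ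
      ν≤aμ = leastᶠ ba (apply a μ) (app-cong a (fixed ab))

      μ≤bν : μ ≤ˢ apply b ν
      μ≤bν = leastᶠ ab (apply b ν) (app-cong b (fixed ba))

      aμ≗ν : apply a μ ≗ˢ ν
      aμ≗ν = antisymˢ {σ = apply a μ} {τ = ν}
        (λ j → subst (Pointwise _ (apply a μ j)) (fixed ba j) (monotone a μ≤bν j)) ν≤aμ

    ⟦coe⟧ : ∀ {m n} (eq : m ≡ n) (σ : Str m) i → ⟦_⟧ I (coe eq) σ i ≡ Vec.cast eq (σ i)
    ⟦coe⟧ refl σ i = sym (Vec.cast-is-id refl (σ i))

    cast-irr : ∀ {m n} {xs ys : Vec V m} (eq : m ≡ n) → xs ≡ ys → Vec.cast eq xs ≡ Vec.cast eq ys
    cast-irr eq = cong (Vec.cast eq)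

    assoc⁻ : ∀ {a b c} (xs : Vec V a) (ys : Vec V b) (zs : Vec V c) →
             Vec.cast (sym (ℕ.+-assoc a b c)) (xs ++ (ys ++ zs)) ≡ (xs ++ ys) ++ zs
    assoc⁻ {a} {b} {c} xs ys zs = Vec.cast-sym (ℕ.+-assoc a b c) (Vec.++-assoc-eqFree xs ys zs)

    -- Substituting the least solution for one block of feedback wires into the
    -- other solves the system for both.
    bekič : ∀ {x y} (f : Fn (x + y) (x + y)) (A : Fn y x) (B : Fn y y) →
            (∀ ρ → take x ∘ apply f (apply A ρ ⧺ ρ) ≗ˢ apply A ρ) →
            (∀ ρ τ → take x ∘ apply f (τ ⧺ ρ) ≤ˢ τ → apply A ρ ≤ˢ τ) →
            (∀ ρ → apply B ρ ≗ˢ drop x ∘ apply f (apply A ρ ⧺ ρ)) →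
            lfp (apply f) ≗ˢ apply A (lfp (apply B)) ⧺ lfp (apply B)
    bekič {x} {y} f A B A-fix A-least B-def =
      antisymˢ {σ = μ} {τ = apply A ν ⧺ ν}
        (leastᶠ f (apply A ν ⧺ ν) λ i → trans (sym (Vec.take++drop≡id x _))
          (cong₂ _++_ (A-fix ν i) (trans (sym (B-def ν i)) (fixed B i))))
        (λ i → subst (Pointwise _ (apply A ν i ++ ν i)) (Vec.take++drop≡id x (μ i))
          (Pointwise.++⁺ (Pointwise.trans (⊑-trans values) (monotone A ν≤μ₂ i) (Aμ₂≤μ₁ i)) (ν≤μ₂ i)))
      where
      μ = lfp (apply f)
      ν = lfp (apply B)

      μ₁ : Str x
      μ₁ = take x ∘ μ

      μ₂ : Str y
      μ₂ = drop x ∘ μ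

      glue : μ₁ ⧺ μ₂ ≗ˢ μ
      glue i = Vec.take++drop≡id x (μ i)

      μ-fix : apply f (μ₁ ⧺ μ₂) ≗ˢ μ
      μ-fix i = trans (app-cong f glue i) (fixed f i)

      Aμ₂≤μ₁ : apply A μ₂ ≤ˢ μ₁
      Aμ₂≤μ₁ = A-least μ₂ μ₁ λ i → ⊑-reflexive (values ^ x) (cong (take x) (μ-fix i))

      ν≤μ₂ : ν ≤ˢ μ₂
      ν≤μ₂ = least B μ₂ λ i → subst₂ (Pointwise _) (sym (B-def μ₂ i)) (cong (drop x) (μ-fix i))
        (drop-mono {values} x (monotone f (λ j → Pointwise.++⁺ (Aμ₂≤μ₁ j) (Pointwise.refl (⊑-refl values))) i))

  ⟦⟧-cong : ∀ {m n} {F G : SCirc Sg m n} → F ≈ G → ∀ σ i → ⟦_⟧ I F σ i ≡ ⟦_⟧ I G σ i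
  ⟦⟧-cong ≈-refl        σ i = refl
  ⟦⟧-cong (≈-sym p)     σ i = sym (⟦⟧-cong p σ i)
  ⟦⟧-cong (≈-trans p q) σ i = trans (⟦⟧-cong p σ i) (⟦⟧-cong q σ i)
  ⟦⟧-cong (⨾-cong {f′ = f′} {g = g} p q) σ i =
    trans (app-cong (denotation I g) (⟦⟧-cong p σ) i) (⟦⟧-cong q (⟦_⟧ I f′ σ) i)
  ⟦⟧-cong (⊗-cong {m = m} p q) σ i = cong₂ _++_ (⟦⟧-cong p (take m ∘ σ) i) (⟦⟧-cong q (drop m ∘ σ) i)
  ⟦⟧-cong (Tr-cong {x} {f = f} {f′} p) σ i = cong (drop x) (trans
    (app-cong (denotation I f) (⧺-cong
      (lfp-ext (feedback I x (denotation I f) σ) (feedback I x (denotation I f′) σ)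
        (λ τ j → cong (take x) (⟦⟧-cong p (τ ⧺ σ) j)))
      (λ _ → refl)) i)
    (⟦⟧-cong p _ i))
  ⟦⟧-cong ⨾-identityˡ σ i = refl
  ⟦⟧-cong ⨾-identityʳ σ i = refl
  ⟦⟧-cong ⨾-assoc     σ i = refl
  ⟦⟧-cong (⊗-id {m = m}) σ i = Vec.take++drop≡id m (σ i)
  ⟦⟧-cong (⊗-⨾ {f = f} {g} {f′} {g′}) σ i = cong₂ _++_
    (app-cong (denotation I g) (λ j → sym (take-++ (⟦_⟧ I f _ j))) i)
    (app-cong (denotation I g′) (λ j → sym (drop-++ (⟦_⟧ I f _ j))) i)
  ⟦⟧-cong ⊗-identityˡ σ i = refl
  ⟦⟧-cong (⊗-identityʳ {m = m} {n} {f}) σ i = begin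
    ⟦_⟧ I (coe (ℕ.+-identityʳ n)) _ i
      ≡⟨ ⟦coe⟧ (ℕ.+-identityʳ n) _ i ⟩
    Vec.cast (ℕ.+-identityʳ n) (⟦_⟧ I f (take m ∘ σ) i ++ drop m (σ i))
      ≡⟨ cong (λ z → Vec.cast (ℕ.+-identityʳ n) (⟦_⟧ I f (take m ∘ σ) i ++ z)) (sym (empty _)) ⟩
    Vec.cast (ℕ.+-identityʳ n) (⟦_⟧ I f (take m ∘ σ) i ++ [])
      ≡⟨ Vec.++-identityʳ-eqFree _ ⟩
    ⟦_⟧ I f (take m ∘ σ) i
      ≡⟨ app-cong (denotation I f) (λ j → trans (take-identity m (σ j)) (sym (⟦coe⟧ (ℕ.+-identityʳ m) σ j))) i ⟩
    ⟦_⟧ I f (⟦_⟧ I (coe (ℕ.+-identityʳ m)) σ) i ∎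
    where
    open ≡-Reasoning
    take-identity : ∀ m (xs : Vec V (m + 0)) → take m xs ≡ Vec.cast (ℕ.+-identityʳ m) xs
    take-identity zero    []       = refl
    take-identity (suc m) (x ∷ xs) = cong (x ∷_) (take-identity m xs)
  ⟦⟧-cong (⊗-assoc {m = m} {n} {m′} {n′} {m″} {n″} {f} {g} {h}) σ i = begin
    ⟦_⟧ I (coe (ℕ.+-assoc n n′ n″)) _ i
      ≡⟨ ⟦coe⟧ (ℕ.+-assoc n n′ n″) _ i ⟩
    Vec.cast (ℕ.+-assoc n n′ n″) ((⟦_⟧ I f _ i ++ ⟦_⟧ I g _ i) ++ ⟦_⟧ I h _ i)
      ≡⟨ Vec.++-assoc-eqFree (⟦_⟧ I f _ i) (⟦_⟧ I g _ i) (⟦_⟧ I h _ i) ⟩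
    ⟦_⟧ I f _ i ++ (⟦_⟧ I g _ i ++ ⟦_⟧ I h _ i)
      ≡⟨ cong₂ _++_
           (app-cong (denotation I f) (λ j → trans (take-assoc m m′ (σ j)) (cong (take m) (sym (c j)))) i)
           (cong₂ _++_
             (app-cong (denotation I g) (λ j → trans (mid-assoc m m′ (σ j)) (cong (take m′ ∘ drop m) (sym (c j)))) i)
             (app-cong (denotation I h) (λ j → trans (drop-assoc m m′ (σ j)) (cong (drop m′ ∘ drop m) (sym (c j)))) i)) ⟩
    ⟦_⟧ I (f ⊗ (g ⊗ h)) (⟦_⟧ I (coe (ℕ.+-assoc m m′ m″)) σ) i ∎
    where
    open ≡-Reasoning
    c : ∀ j → ⟦_⟧ I (coe (ℕ.+-assoc m m′ m″)) σ j ≡ Vec.cast (ℕ.+-assoc m m′ m″) (σ j)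
    c = ⟦coe⟧ (ℕ.+-assoc m m′ m″) σ
  ⟦⟧-cong (swap-natural {m = m} {m′ = m′} {f = f} {g}) σ i = cong₂ _++_
    (trans (drop-++ (⟦_⟧ I f _ i)) (app-cong (denotation I g) (λ j → sym (take-++ (drop m (σ j)))) i))
    (trans (take-++ (⟦_⟧ I f _ i)) (app-cong (denotation I f) (λ j → sym (drop-++ (drop m (σ j)))) i))
  ⟦⟧-cong (swap-involutive {m = m}) σ i =
    trans (cong₂ _++_ (drop-++ (drop m (σ i))) (take-++ (drop m (σ i)))) (Vec.take++drop≡id m (σ i))
  ⟦⟧-cong (swap-hexagon {m = m} {n} {p}) σ i = sym (begin
    ⟦_⟧ I (coe (sym (ℕ.+-assoc n p m))) (λ j → take n (w₃ j) ++ (drop m (drop n (w₃ j)) ++ take m (drop n (w₃ j)))) i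
      ≡⟨ ⟦coe⟧ (sym (ℕ.+-assoc n p m)) _ i ⟩
    Vec.cast (sym (ℕ.+-assoc n p m)) (take n (w₃ i) ++ (drop m (drop n (w₃ i)) ++ take m (drop n (w₃ i))))
      ≡⟨ assoc⁻ (take n (w₃ i)) _ _ ⟩
    (take n (w₃ i) ++ drop m (drop n (w₃ i))) ++ take m (drop n (w₃ i))
      ≡⟨ cong (λ z → (take n z ++ drop m (drop n z)) ++ take m (drop n z)) w₃-is ⟩
    (take n (b ++ (a ++ c)) ++ drop m (drop n (b ++ (a ++ c)))) ++ take m (drop n (b ++ (a ++ c)))
      ≡⟨ cong₂ _++_ (cong₂ _++_ (take-++ b) (trans (cong (drop m) (drop-++ b)) (drop-++ a)))
                    (trans (cong (take m) (drop-++ b)) (take-++ a)) ⟩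
    (b ++ c) ++ a
      ≡⟨ cong (_++ a) (Vec.take++drop≡id n (drop m (σ i))) ⟩
    drop m (σ i) ++ take m (σ i) ∎)
    where
    open ≡-Reasoning
    a = take m (σ i)
    b = take n (drop m (σ i))
    c = drop n (drop m (σ i))

    w₁ : Str ((m + n) + p)
    w₁ = ⟦_⟧ I (coe (sym (ℕ.+-assoc m n p))) σ

    w₂ : Str ((n + m) + p)
    w₂ j = (drop m (take (m + n) (w₁ j)) ++ take m (take (m + n) (w₁ j))) ++ drop (m + n) (w₁ j)

    w₃ : Str (n + (m + p))
    w₃ = ⟦_⟧ I (coe (ℕ.+-assoc n m p)) w₂

    w₁-is : w₁ i ≡ (a ++ b) ++ c
    w₁-is = begin
      w₁ i
        ≡⟨ ⟦coe⟧ (sym (ℕ.+-assoc m n p)) σ i ⟩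
      Vec.cast (sym (ℕ.+-assoc m n p)) (σ i)
        ≡⟨ cong (Vec.cast _) (sym (trans (cong (a ++_) (Vec.take++drop≡id n (drop m (σ i)))) (Vec.take++drop≡id m (σ i)))) ⟩
      Vec.cast (sym (ℕ.+-assoc m n p)) (a ++ (b ++ c))
        ≡⟨ assoc⁻ a b c ⟩
      (a ++ b) ++ c ∎

    w₃-is : w₃ i ≡ b ++ (a ++ c)
    w₃-is = begin
      w₃ i
        ≡⟨ ⟦coe⟧ (ℕ.+-assoc n m p) w₂ i ⟩
      Vec.cast (ℕ.+-assoc n m p) (w₂ i)
        ≡⟨ Vec.++-assoc-eqFree (drop m (take (m + n) (w₁ i))) _ _ ⟩
      drop m (take (m + n) (w₁ i)) ++ (take m (take (m + n) (w₁ i)) ++ drop (m + n) (w₁ i))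
        ≡⟨ cong (λ z → drop m (take (m + n) z) ++ (take m (take (m + n) z) ++ drop (m + n) z)) w₁-is ⟩
      drop m (take (m + n) ((a ++ b) ++ c)) ++ (take m (take (m + n) ((a ++ b) ++ c)) ++ drop (m + n) ((a ++ b) ++ c))
        ≡⟨ cong₂ _++_ (trans (cong (drop m) (take-++ (a ++ b))) (drop-++ a))
             (cong₂ _++_ (trans (cong (take m) (take-++ (a ++ b))) (take-++ a)) (drop-++ (a ++ b))) ⟩
      b ++ (a ++ c) ∎
  ⟦⟧-cong (Tr-natural {x} {f = f} {g} {h}) σ i = trans
    (drop-++ (take x (⟦_⟧ I f _ i)))
    (app-cong (denotation I h) (λ j → cong (drop x) (trans
      (app-cong (denotation I f) (pre (leastFeedback I x (denotation I F) σ)) j)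
      (app-cong (denotation I f) (⧺-cong
        (lfp-ext (feedback I x (denotation I F) σ) (feedback I x (denotation I f) (⟦_⟧ I g σ))
          (λ τ k → trans (take-++ (take x (⟦_⟧ I f _ k)))
                         (cong (take x) (app-cong (denotation I f) (pre τ) k))))
        (λ _ → refl)) j))) i)
    where
    F = (id x ⊗ g) ⨾ f ⨾ (id x ⊗ h)

    pre : ∀ τ → ⟦_⟧ I (id x ⊗ g) (τ ⧺ σ) ≗ˢ τ ⧺ ⟦_⟧ I g σ
    pre τ j = cong₂ _++_ (take-++ (τ j)) (app-cong (denotation I g) (λ k → drop-++ (τ k)) j)
  ⟦⟧-cong (Tr-sliding {x} {y} {m} {n} {f} {u}) σ i = begin
    drop x (⟦_⟧ I u _ i ++ drop y (⟦_⟧ I f (μ ⧺ σ) i))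
      ≡⟨ drop-++ (⟦_⟧ I u _ i) ⟩
    drop y (⟦_⟧ I f (μ ⧺ σ) i)
      ≡⟨ cong (drop y) (app-cong (denotation I f) (λ j → sym (trans (pre ν j) (cong (_++ σ j) (uν≗μ j)))) i) ⟩
    drop y (⟦_⟧ I f (⟦_⟧ I (u ⊗ id m) (ν ⧺ σ)) i) ∎
    where
    open ≡-Reasoning
    L = feedback I x (denotation I (f ⨾ (u ⊗ id n))) σ
    R = feedback I y (denotation I ((u ⊗ id m) ⨾ f)) σ
    μ = lfp (apply L)
    ν = lfp (apply R)

    pre : ∀ τ → ⟦_⟧ I (u ⊗ id m) (τ ⧺ σ) ≗ˢ ⟦_⟧ I u τ ⧺ σ
    pre τ j = cong₂ _++_ (app-cong (denotation I u) (λ k → take-++ (τ k)) j) (drop-++ (τ j))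

    a : Fn x y
    a = record
      { apply    = λ τ j → take y (⟦_⟧ I f (τ ⧺ σ) j)
      ; monotone = λ p j → take-mono {values} y (monotone (denotation I f)
                     (λ k → Pointwise.++⁺ (p k) (Pointwise.refl (⊑-refl values))) j)
      ; causal   = λ j p → cong (take y) (causal (denotation I f) j λ k k≤j → cong (_++ σ k) (p k k≤j))
      }

    L≗ : μ ≗ˢ lfp (apply (composeᴰ I a (denotation I u)))
    L≗ = lfp-ext L (composeᴰ I a (denotation I u)) λ τ j → take-++ (⟦_⟧ I u _ j)

    R≗ : ν ≗ˢ lfp (apply (composeᴰ I (denotation I u) a))
    R≗ = lfp-ext R (composeᴰ I (denotation I u) a) λ τ j → cong (take y) (app-cong (denotation I f) (pre τ) j)

    uν≗μ : ⟦_⟧ I u ν ≗ˢ μ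
    uν≗μ j = trans (app-cong (denotation I u) R≗ j) (trans (rolling a (denotation I u) j) (sym (L≗ j)))
  ⟦⟧-cong (Tr-vanishing₀ {f = f}) σ i =
    app-cong (denotation I f) (λ j → cong (_++ σ j) (sym (empty (leastFeedback I 0 (denotation I f) σ j)))) i
  ⟦⟧-cong (Tr-vanishing₊ {x} {y} {m} {n} {f}) σ i = begin
    drop (x + y) (⟦_⟧ I f (μ ⧺ σ) i)
      ≡⟨ drop-assoc x y _ ⟩
    drop y (drop x (Vec.cast (ℕ.+-assoc x y n) (⟦_⟧ I f (μ ⧺ σ) i)))
      ≡⟨ cong (drop y ∘ drop x ∘ Vec.cast (ℕ.+-assoc x y n)) (app-cong (denotation I f) (⧺-cong μ≗ (λ _ → refl)) i) ⟩
    drop y (drop x (Vec.cast (ℕ.+-assoc x y n) (⟦_⟧ I f ((apply A ν ⧺ ν) ⧺ σ) i)))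
      ≡⟨ cong (drop y ∘ drop x) (sym (F-is (apply A ν) ν i)) ⟩
    drop y (drop x (⟦_⟧ I F (apply A ν ⧺ (ν ⧺ σ)) i)) ∎
    where
    open ≡-Reasoning
    F = coe (sym (ℕ.+-assoc x y m)) ⨾ f ⨾ coe (ℕ.+-assoc x y n)

    F-is : ∀ τ ρ → ⟦_⟧ I F (τ ⧺ (ρ ⧺ σ)) ≗ˢ Vec.cast (ℕ.+-assoc x y n) ∘ ⟦_⟧ I f ((τ ⧺ ρ) ⧺ σ)
    F-is τ ρ j = trans (⟦coe⟧ (ℕ.+-assoc x y n) _ j)
      (cong (Vec.cast (ℕ.+-assoc x y n)) (app-cong (denotation I f)
        (λ k → trans (⟦coe⟧ (sym (ℕ.+-assoc x y m)) _ k) (assoc⁻ (τ k) (ρ k) (σ k))) j))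

    W : Fn (x + y) (x + y)
    W = feedback I (x + y) (denotation I f) σ

    B : Fn y y
    B = feedback I y (denotation I (Tr x F)) σ

    μ = lfp (apply W)
    ν = lfp (apply B)

    A : Fn y x
    A = record
      { apply    = λ ρ → leastFeedback I x (denotation I F) (ρ ⧺ σ)
      ; monotone = λ {ρ} {ρ′} ρ≤ρ′ → least (feedback I x (denotation I F) (ρ ⧺ σ)) _ λ j →
          subst (Pointwise _ _) (fixed (feedback I x (denotation I F) (ρ′ ⧺ σ)) j)
            (take-mono {values} x (monotone (denotation I F)
              (λ k → Pointwise.++⁺ (Pointwise.refl (⊑-refl values) {leastFeedback I x (denotation I F) (ρ′ ⧺ σ) k})
                       (Pointwise.++⁺ (ρ≤ρ′ k) (Pointwise.refl (⊑-refl values) {σ k}))) j))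
      ; causal   = λ {ρ} {ρ′} j p → Kleene.iterate-causal {values ^ x} j
          (λ k k≤j q → cong (take x) (causal (denotation I F) k λ l l≤k →
            cong₂ _++_ (q l l≤k) (cong (_++ σ l) (p l (ℕ.≤-trans l≤k k≤j)))))
          (suc j * size (values ^ x)) j ℕ.≤-refl
      }

    to-W : ∀ τ ρ → take x ∘ ⟦_⟧ I F (τ ⧺ (ρ ⧺ σ)) ≗ˢ take x ∘ apply W (τ ⧺ ρ)
    to-W τ ρ j = trans (cong (take x) (F-is τ ρ j)) (sym (take-assoc x y _))

    μ≗ : μ ≗ˢ apply A ν ⧺ ν
    μ≗ = bekič W A B
      (λ ρ j → trans (sym (to-W (apply A ρ) ρ j)) (fixed (feedback I x (denotation I F) (ρ ⧺ σ)) j))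
      (λ ρ τ p → least (feedback I x (denotation I F) (ρ ⧺ σ)) τ λ j →
        subst (λ z → Pointwise _ z (τ j)) (sym (to-W τ ρ j)) (p j))
      (λ ρ j → trans (cong (take y ∘ drop x) (F-is (apply A ρ) ρ j)) (sym (mid-assoc x y _)))
  ⟦⟧-cong (Tr-superposing {x} {m} {n} {p} {q} {f} {g}) σ i = sym (begin
    drop x (⟦_⟧ I F (μ ⧺ σ) i)
      ≡⟨ cong (drop x) (F-is μ i) ⟩
    drop x (take x (⟦_⟧ I f (μ ⧺ σ₁) i) ++ (drop x (⟦_⟧ I f (μ ⧺ σ₁) i) ++ ⟦_⟧ I g σ₂ i))
      ≡⟨ drop-++ (take x (⟦_⟧ I f (μ ⧺ σ₁) i)) ⟩
    drop x (⟦_⟧ I f (μ ⧺ σ₁) i) ++ ⟦_⟧ I g σ₂ i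
      ≡⟨ cong (λ z → drop x z ++ ⟦_⟧ I g σ₂ i) (app-cong (denotation I f) (⧺-cong μ≗ (λ _ → refl)) i) ⟩
    ⟦_⟧ I (Tr x f ⊗ g) σ i ∎)
    where
    open ≡-Reasoning
    F = coe (sym (ℕ.+-assoc x m p)) ⨾ (f ⊗ g) ⨾ coe (ℕ.+-assoc x n q)

    σ₁ : Str m
    σ₁ = take m ∘ σ

    σ₂ : Str p
    σ₂ = drop m ∘ σ

    μ = leastFeedback I x (denotation I F) σ

    in-is : ∀ τ → ⟦_⟧ I (coe (sym (ℕ.+-assoc x m p))) (τ ⧺ σ) ≗ˢ (τ ⧺ σ₁) ⧺ σ₂
    in-is τ j = trans (⟦coe⟧ (sym (ℕ.+-assoc x m p)) _ j)
      (trans (cong (λ z → Vec.cast (sym (ℕ.+-assoc x m p)) (τ j ++ z)) (sym (Vec.take++drop≡id m (σ j))))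
             (assoc⁻ (τ j) (σ₁ j) (σ₂ j)))

    F-is : ∀ τ → ⟦_⟧ I F (τ ⧺ σ) ≗ˢ
           (take x ∘ ⟦_⟧ I f (τ ⧺ σ₁)) ⧺ ((drop x ∘ ⟦_⟧ I f (τ ⧺ σ₁)) ⧺ ⟦_⟧ I g σ₂)
    F-is τ j = begin
      ⟦_⟧ I F (τ ⧺ σ) j
        ≡⟨ ⟦coe⟧ (ℕ.+-assoc x n q) _ j ⟩
      Vec.cast (ℕ.+-assoc x n q) (⟦_⟧ I f _ j ++ ⟦_⟧ I g _ j)
        ≡⟨ cong (Vec.cast (ℕ.+-assoc x n q)) (cong₂ _++_
             (app-cong (denotation I f) (λ k → trans (cong (take (x + m)) (in-is τ k)) (take-++ (τ k ++ σ₁ k))) j)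
             (app-cong (denotation I g) (λ k → trans (cong (drop (x + m)) (in-is τ k)) (drop-++ (τ k ++ σ₁ k))) j)) ⟩
      Vec.cast (ℕ.+-assoc x n q) (⟦_⟧ I f (τ ⧺ σ₁) j ++ ⟦_⟧ I g σ₂ j)
        ≡⟨ cong (λ z → Vec.cast (ℕ.+-assoc x n q) (z ++ ⟦_⟧ I g σ₂ j)) (sym (Vec.take++drop≡id x _)) ⟩
      Vec.cast (ℕ.+-assoc x n q) ((take x (⟦_⟧ I f (τ ⧺ σ₁) j) ++ drop x (⟦_⟧ I f (τ ⧺ σ₁) j)) ++ ⟦_⟧ I g σ₂ j)
        ≡⟨ Vec.++-assoc-eqFree (take x (⟦_⟧ I f (τ ⧺ σ₁) j)) _ _ ⟩
      take x (⟦_⟧ I f (τ ⧺ σ₁) j) ++ (drop x (⟦_⟧ I f (τ ⧺ σ₁) j) ++ ⟦_⟧ I g σ₂ j) ∎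

    μ≗ : μ ≗ˢ leastFeedback I x (denotation I f) σ₁
    μ≗ = lfp-ext (feedback I x (denotation I F) σ) (feedback I x (denotation I f) σ₁)
      λ τ j → trans (cong (take x) (F-is τ j)) (take-++ (take x (⟦_⟧ I f (τ ⧺ σ₁) j)))
  ⟦⟧-cong (Tr-yanking {x}) σ i = begin
    drop x (drop x (μ i ++ σ i) ++ take x (μ i ++ σ i))
      ≡⟨ drop-++ (drop x (μ i ++ σ i)) ⟩
    take x (μ i ++ σ i)
      ≡⟨ take-++ (μ i) ⟩
    μ i
      ≡⟨ fixed (feedback I x (denotation I (swap x x)) σ) i ⟨
    take x (drop x (μ i ++ σ i) ++ take x (μ i ++ σ i))
      ≡⟨ take-++ (drop x (μ i ++ σ i)) ⟩
    drop x (μ i ++ σ i)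
      ≡⟨ drop-++ (μ i) ⟩
    σ i ∎
    where
    open ≡-Reasoning
    μ = leastFeedback I x (denotation I (swap x x)) σ

record Completeness {Sg : Signature} (I : Interpretation Sg) : Set where
  open Interpretation I using (values)
  field
    ‖_‖          : ∀ {m n} → MonotoneMap (values ^ m) (values ^ n) → SCirc Sg m n
    ‖‖-form      : ∀ {m n} (f : MonotoneMap (values ^ m) (values ^ n)) →
                   ∃ λ k → ∃ λ (vs : ∣ values ^ k ∣) → ∃ λ (G : CCirc Sg (k + m) n) →
                   ‖ f ‖ ≈ (vs ^∞ ⊗ id m) ⨾ sequentially G
    ‖‖-denotation : ∀ {m n} (f : MonotoneMap (values ^ m) (values ^ n)) σ i →
                   ⟦_⟧ I ‖ f ‖ σ i ≡ MonotoneMap.apply f (σ i)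

record MealyMachine {Sg : Signature} (I : Interpretation Sg) (m n : ℕ) : Set₁ where
  open Interpretation I using (values)
  field
    S  : FiniteLattice
    f  : MonotoneMap (S ⊠ values ^ m) (S ⊠ values ^ n)
    s₀ : ∣ S ∣

  f₀ : ∣ S ∣ → ∣ values ^ m ∣ → ∣ S ∣
  f₀ s x = proj₁ (MonotoneMap.apply f (s , x))

  f₁ : ∣ S ∣ → ∣ values ^ m ∣ → ∣ values ^ n ∣
  f₁ s x = proj₂ (MonotoneMap.apply f (s , x))

  stateAt : Stream ∣ values ^ m ∣ → Stream ∣ S ∣
  stateAt σ zero    = s₀
  stateAt σ (suc i) = f₀ (stateAt σ i) (σ i)

  !_ : Stream ∣ values ^ m ∣ → Stream ∣ values ^ n ∣
  !_ σ i = f₁ (stateAt σ i) (σ i)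

-- Words are compared by length first and then lexicographically: under the
-- purely alphabetical order a nonempty set of words, such as b, ab, aab, …,
-- need not have a minimal element.
module WordOrder {L : FiniteLattice} {_≤_ : Rel ∣ L ∣ 0ℓ} (≤-total : IsTotalOrder _≡_ _≤_) (m : ℕ) where
  open FiniteLattice L using (_≟_)

  letterOrder : DecTotalOrder 0ℓ 0ℓ 0ℓ
  letterOrder = record
    { isDecTotalOrder = record
      { isTotalOrder = ≤-total
      ; _≟_          = _≟_
      ; _≤?_         = total∧dec⇒dec reflexive antisym total _≟_
      }
    }
    where open IsTotalOrder ≤-total

  wordOrder : DecTotalOrder 0ℓ 0ℓ 0ℓ
  wordOrder = On.decTotalOrder
    (×Lex.×-decTotalOrder ℕ.≤-decTotalOrder (ListLex.≤-decTotalOrder (VecLex.≤-decTotalOrder letterOrder m)))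
    (λ (w : List ∣ L ^ m ∣) → length w , w)

  open DecTotalOrder wordOrder public using () renaming (_≤_ to _≤⋆_)

  shorter : ∀ {w w′} → length w ℕ.< length w′ → w ≤⋆ w′
  shorter p = inj₁ (ℕ.<⇒≤ p , ℕ.<⇒≢ p)

module Accessibility {Sg : Signature} {I : Interpretation Sg} {m n : ℕ} (M : MealyMachine I m n) where
  open Interpretation I using (values)
  open MealyMachine M
  open FiniteLattice S using (_≟_; size; finite; elements; ∈-elements)

  Word : Set
  Word = List ∣ values ^ m ∣

  after : Word → ∣ S ∣
  after = List.foldl f₀ s₀

  _Reaches_ : Word → ∣ S ∣ → Set
  w Reaches s = after w ≡ s

  Accessible : ∣ S ∣ → Set
  Accessible s = ∃ λ w → w Reaches s

  -- A subposet of S closed under transitions, in general not a lattice.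
  AccessibleState : Set
  AccessibleState = ∃ Accessible

  next : AccessibleState → ∣ values ^ m ∣ → AccessibleState
  next (s , w , p) x = f₀ s x , w List.∷ʳ x , trans (List.foldl-∷ʳ f₀ s₀ x w) (cong (λ s → f₀ s x) p)

  initial : AccessibleState
  initial = s₀ , [] , refl

  wordsUpTo : ℕ → List Word
  wordsUpTo zero    = [] ∷ []
  wordsUpTo (suc l) = [] ∷ List.cartesianProductWith _∷_ (FiniteLattice.elements (values ^ m)) (wordsUpTo l)

  ∈-wordsUpTo : ∀ l w → length w ℕ.≤ l → w ∈ wordsUpTo l
  ∈-wordsUpTo zero    []      _       = here refl
  ∈-wordsUpTo (suc l) []      _       = here refl
  ∈-wordsUpTo (suc l) (x ∷ w) (s≤s p) =
    there (∈.∈-cartesianProductWith⁺ _∷_ (FiniteLattice.∈-elements (values ^ m) x) (∈-wordsUpTo l w p))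

  shorten : ∀ w → size ℕ.< length w → ∃ λ w′ → length w′ ℕ.< length w × after w′ ≡ after w
  shorten w p with Fin.pigeonhole p (λ i → Inverse.to finite (after (List.take (toℕ i) w)))
  ... | i , j , i<j , eq = List.take (toℕ i) w List.++ List.drop (toℕ j) w , shorter , same
    where
    shorter : length (List.take (toℕ i) w List.++ List.drop (toℕ j) w) ℕ.< length w
    shorter = begin-strict
      length (List.take (toℕ i) w List.++ List.drop (toℕ j) w)
        ≡⟨ List.length-++ (List.take (toℕ i) w) ⟩
      length (List.take (toℕ i) w) + length (List.drop (toℕ j) w)
        ≡⟨ cong₂ _+_ (List.length-take (toℕ i) w) (List.length-drop (toℕ j) w) ⟩
      toℕ i ℕ.⊓ length w + (length w ℕ.∸ toℕ j)
        ≤⟨ ℕ.+-monoˡ-≤ _ (ℕ.m⊓n≤m (toℕ i) (length w)) ⟩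
      toℕ i + (length w ℕ.∸ toℕ j)
        <⟨ ℕ.+-monoˡ-< _ i<j ⟩
      toℕ j + (length w ℕ.∸ toℕ j)
        ≡⟨ ℕ.m+[n∸m]≡n (ℕ.<⇒≤ (Fin.toℕ<n j)) ⟩
      length w ∎
      where open ℕ.≤-Reasoning

    collide : after (List.take (toℕ i) w) ≡ after (List.take (toℕ j) w)
    collide = trans (sym (Inverse.strictlyInverseʳ finite _))
                (trans (cong (Inverse.from finite) eq) (Inverse.strictlyInverseʳ finite _))

    same : after (List.take (toℕ i) w List.++ List.drop (toℕ j) w) ≡ after w
    same = begin
      after (List.take (toℕ i) w List.++ List.drop (toℕ j) w)
        ≡⟨ List.foldl-++ f₀ s₀ (List.take (toℕ i) w) _ ⟩
      List.foldl f₀ (after (List.take (toℕ i) w)) (List.drop (toℕ j) w)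
        ≡⟨ cong (λ s → List.foldl f₀ s (List.drop (toℕ j) w)) collide ⟩
      List.foldl f₀ (after (List.take (toℕ j) w)) (List.drop (toℕ j) w)
        ≡⟨ List.foldl-++ f₀ s₀ (List.take (toℕ j) w) _ ⟨
      after (List.take (toℕ j) w List.++ List.drop (toℕ j) w)
        ≡⟨ cong after (List.take++drop≡id (toℕ j) w) ⟩
      after w ∎
      where open ≡-Reasoning

  short : ∀ w → ∃ λ w′ → length w′ ℕ.≤ size × after w′ ≡ after w
  short w = go w (<-wellFounded (length w))
    where
    go : ∀ w → Acc ℕ._<_ (length w) → ∃ λ w′ → length w′ ℕ.≤ size × after w′ ≡ after w
    go w (acc rs) with length w ℕ.≤? size
    ... | yes p = w , p , refl
    ... | no ¬p =
      let w₁ , w₁<w , eq₁ = shorten w (ℕ.≰⇒> ¬p)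
          w₂ , w₂≤  , eq₂ = go w₁ (rs w₁<w)
      in w₂ , w₂≤ , trans eq₂ eq₁

  accessible? : Decidable Accessible
  accessible? s = map′ (Any.satisfied)
    (λ (w , p) → let w′ , w′≤ , eq = short w in
      Any.map (λ { refl → trans eq p }) (∈-wordsUpTo size w′ w′≤))
    (Any.any? (λ w → after w ≟ s) (wordsUpTo size))

  private
    keep : ∀ {s} → Dec (Accessible s) → Maybe AccessibleState
    keep (yes a) = just (_ , a)
    keep (no  _) = nothing

  accessibleStates : List AccessibleState
  accessibleStates = List.mapMaybe (λ s → keep (accessible? s)) elements

  accessibleStates-complete : ∀ ((s , _) : AccessibleState) → Any (λ r → proj₁ r ≡ s) accessibleStates
  accessibleStates-complete (s , a) = go elements (∈-elements s)
    where
    go : ∀ ss → s ∈ ss → Any (λ r → proj₁ r ≡ s) (List.mapMaybe (λ s → keep (accessible? s)) ss)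
    go (s′ ∷ ss) (here refl) with accessible? s′
    ... | yes _ = here refl
    ... | no ¬a = contradiction a ¬a
    go (s′ ∷ ss) (there p) with accessible? s′
    ... | yes _ = there (go ss p)
    ... | no  _ = go ss p

  module ChosenOrder {_≤_ : Rel ∣ values ∣ 0ℓ} (≤-total : IsTotalOrder _≡_ _≤_) where
    open WordOrder {values} ≤-total m

    open DecTotalOrder wordOrder using (totalOrder) renaming (trans to ≤⋆-trans)
    open Extrema totalOrder using (min; min≤⊤; min≤xs; argmin-all)

    -- Only the finitely many words no longer than the given one can be smaller.
    leastWord : AccessibleState → Word
    leastWord (s , w , _) = min w (List.filter (λ w′ → after w′ ≟ s) (wordsUpTo (length w)))

    leastWord-reaches : ∀ s → leastWord s Reaches proj₁ s
    leastWord-reaches (s , w , p) =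
      argmin-all (λ w → w) {P = _Reaches s} p (All.tabulate λ w∈ →
        proj₂ (∈.∈-filter⁻ (λ w′ → after w′ ≟ s) {xs = wordsUpTo (length w)} w∈))

    leastWord-minimal : ∀ s w → w Reaches proj₁ s → leastWord s ≤⋆ w
    leastWord-minimal (s , w , p) w′ p′ with length w′ ℕ.≤? length w
    ... | yes w′≤w = All.lookup (min≤xs w (List.filter (λ w′ → after w′ ≟ s) (wordsUpTo (length w))))
                       (∈.∈-filter⁺ (λ w′ → after w′ ≟ s) (∈-wordsUpTo (length w) w′ w′≤w) p′)
    ... | no  w′≰w =
      ≤⋆-trans {leastWord (s , w , p)} {w} {w′}
        (min≤⊤ w (List.filter (λ w′ → after w′ ≟ s) (wordsUpTo (length w)))) (shorter (ℕ.≰⇒> w′≰w))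

    -- Elements are compared through their least words only, so two proofs that a
    -- state is accessible are identified.
    stateOrder : DecTotalOrder 0ℓ 0ℓ 0ℓ
    stateOrder = On.decTotalOrder wordOrder leastWord

    -- Repetition-free, because accessibleStates runs through S once.
    listing : List AccessibleState
    listing = Sort.sort stateOrder accessibleStates

    listing-complete : ∀ ((s , _) : AccessibleState) → Any (λ r → proj₁ r ≡ s) listing
    listing-complete s =
      let r , r∈ , eq = find (accessibleStates-complete s)
      in lose (∈-resp-↭ (↭-sym (Sort.sort-↭ stateOrder accessibleStates)) r∈) eq

module _ {Sg : Signature} (I : Interpretation Sg) where
  open Interpretation I using (values)
  open FiniteLattice values using (⊤; ⊥; _⊑_; ⊑-refl; ⊑-trans; ⊑-reflexive; ⊑-antisym; maximum; minimum; _≟_)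

  encode : ∀ {A : Set} {_⪯_ : Rel A 0ℓ} → Binary.Decidable _⪯_ → (rs : List A) → A → Vec ∣ values ∣ (length rs)
  encode _⪯?_ rs s = Vec.map (λ r → if ⌊ r ⪯? s ⌋ then ⊤ else ⊥) (Vec.fromList rs)

  private
    bit-mono : ∀ {A B : Set} (p : Dec A) (q : Dec B) → (A → B) →
               (if ⌊ p ⌋ then ⊤ else ⊥) ⊑ (if ⌊ q ⌋ then ⊤ else ⊥)
    bit-mono (no  _) q       A→B = minimum _
    bit-mono (yes a) (yes b) A→B = ⊑-refl
    bit-mono (yes a) (no ¬b) A→B = contradiction (A→B a) ¬b

    bit-reflects : ∀ {A B : Set} (p : Dec A) (q : Dec B) → ⊤ ≢ ⊥ →
                   (if ⌊ p ⌋ then ⊤ else ⊥) ⊑ (if ⌊ q ⌋ then ⊤ else ⊥) → A → B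
    bit-reflects p       (yes b) ⊤≢⊥ le a = b
    bit-reflects (yes _) (no ¬b) ⊤≢⊥ le a = contradiction (⊑-antisym le (minimum _)) ⊤≢⊥
    bit-reflects (no ¬a) (no ¬b) ⊤≢⊥ le a = contradiction a ¬a

  encode-mono : ∀ {A : Set} {_⪯_ : Rel A 0ℓ} (_⪯?_ : Binary.Decidable _⪯_) → (∀ {a b c} → a ⪯ b → b ⪯ c → a ⪯ c) →
                ∀ rs {s t} → s ⪯ t → Pointwise _⊑_ (encode _⪯?_ rs s) (encode _⪯?_ rs t)
  encode-mono _⪯?_ ⪯-trans []       s⪯t = []
  encode-mono _⪯?_ ⪯-trans (r ∷ rs) s⪯t =
    bit-mono (r ⪯? _) (r ⪯? _) (λ r⪯s → ⪯-trans r⪯s s⪯t) ∷ encode-mono _⪯?_ ⪯-trans rs s⪯t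

  encode-reflects : ∀ {A : Set} {_⪯_ : Rel A 0ℓ} (_⪯?_ : Binary.Decidable _⪯_) → ⊤ ≢ ⊥ →
                    ∀ {rs r s t} → r ∈ rs → Pointwise _⊑_ (encode _⪯?_ rs s) (encode _⪯?_ rs t) → r ⪯ s → r ⪯ t
  encode-reflects _⪯?_ ⊤≢⊥ (here refl) (p ∷ _)  = bit-reflects (_ ⪯? _) (_ ⪯? _) ⊤≢⊥ p
  encode-reflects _⪯?_ ⊤≢⊥ (there r∈)  (_ ∷ ps) = encode-reflects _⪯?_ ⊤≢⊥ r∈ ps

  encode-≢⊥ : ∀ {A : Set} {_⪯_ : Rel A 0ℓ} (_⪯?_ : Binary.Decidable _⪯_) → ⊤ ≢ ⊥ →
              ∀ {rs r s} → r ∈ rs → r ⪯ s → encode _⪯?_ rs s ≢ Vec.replicate (length rs) ⊥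
  encode-≢⊥ _⪯?_ ⊤≢⊥ {rs = r ∷ _} {s = s} (here refl) r⪯s eq with r ⪯? s
  ... | yes _   = ⊤≢⊥ (Vec.∷-injectiveˡ eq)
  ... | no  r⋠s = r⋠s r⪯s
  encode-≢⊥ _⪯?_ ⊤≢⊥ (there r∈) r⪯s eq = encode-≢⊥ _⪯?_ ⊤≢⊥ r∈ r⪯s (Vec.∷-injectiveʳ eq)

  private
    take-⊥ : ∀ k {n} → take k (Vec.replicate (k + n) ⊥) ≡ Vec.replicate k ⊥
    take-⊥ zero    = refl
    take-⊥ (suc k) = cong (⊥ ∷_) (take-⊥ k)

  module _ {m n : ℕ} (M : MealyMachine I m n)
           {_≤_ : Rel ∣ values ∣ 0ℓ} (≤-total : IsTotalOrder _≡_ _≤_) where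
    open MealyMachine M
    open Accessibility M
    open ChosenOrder ≤-total

    private
      module S = FiniteLattice S

    infix 4 _⪯_ _⪯?_

    _⪯_ : Rel AccessibleState 0ℓ
    s ⪯ t = proj₁ s S.⊑ proj₁ t

    _⪯?_ : Binary.Decidable _⪯_
    s ⪯? t = proj₁ s S.⊑? proj₁ t

    width : ℕ
    width = length listing

    γ : AccessibleState → Vec ∣ values ∣ width
    γ = encode _⪯?_ listing

    -- γ[S′] × Vᵐ as a subposet of Vᵏ × Vᵐ, the latter read as Vᵏ⁺ᵐ.
    IsEncoded : Pred ∣ values ^ (width + m) ∣ 0ℓ
    IsEncoded b = ∃ λ s → take width b ≡ γ s

    encodedTransition : ∀ b → IsEncoded b → ∣ values ^ (width + n) ∣
    encodedTransition b (s , _) = γ (next s (drop width b)) ++ f₁ (proj₁ s) (drop width b)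

    isEncoded? : Decidable IsEncoded
    isEncoded? b = map′ Any.satisfied
      (λ (s , eq) → Any.map (λ { {r} refl → trans eq refl }) (listing-complete s))
      (Any.any? (λ s → FiniteLattice._≟_ (values ^ width) (take width b) (γ s)) listing)

    module γ[f] = Completion (values ^ (width + m)) (values ^ (width + n)) IsEncoded isEncoded? encodedTransition

    private
      γ-reflects : ⊤ ≢ ⊥ → ∀ {s t} → Pointwise _⊑_ (γ s) (γ t) → s ⪯ t
      γ-reflects ⊤≢⊥ {s} {t} p =
        let r , r∈ , eq = find (listing-complete s)
        in subst (S._⊑ proj₁ t) eq (encode-reflects _⪯?_ ⊤≢⊥ {s = s} {t = t} r∈ p (S.⊑-reflexive eq))

      degenerate : ⊤ ≡ ⊥ → ∀ {k} (xs ys : Vec ∣ values ∣ k) → Pointwise _⊑_ xs ys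
      degenerate ⊤≡⊥ []       []       = []
      degenerate ⊤≡⊥ (x ∷ xs) (y ∷ ys) =
        ⊑-trans (maximum x) (⊑-trans (⊑-reflexive ⊤≡⊥) (minimum y)) ∷ degenerate ⊤≡⊥ xs ys

    encodedTransition-monotone : ∀ {b b′} (p : IsEncoded b) (q : IsEncoded b′) → Pointwise _⊑_ b b′ →
                                 Pointwise _⊑_ (encodedTransition b p) (encodedTransition b′ q)
    encodedTransition-monotone {b} {b′} (s , p) (t , q) b⊑b′ with ⊤ ≟ ⊥
    ... | yes ⊤≡⊥ = degenerate ⊤≡⊥ _ _
    ... | no  ⊤≢⊥ =
      let s⪯t   = γ-reflects ⊤≢⊥ {s} {t} (subst₂ (Pointwise _⊑_) p q (take-mono {values} width b⊑b′))
          s′ , o = MonotoneMap.monotone f (s⪯t , drop-mono {values} width b⊑b′)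
      in Pointwise.++⁺ (encode-mono _⪯?_ S.⊑-trans listing {next s _} {next t _} s′) o

    encodedTransition-strict : ∀ p → encodedTransition (FiniteLattice.⊥ (values ^ (width + m))) p
                                     ≡ FiniteLattice.⊥ (values ^ (width + n))
    encodedTransition-strict (s , p) with ⊤ ≟ ⊥
    ... | yes ⊤≡⊥ = FiniteLattice.⊑-antisym (values ^ (width + n)) (degenerate ⊤≡⊥ _ _) (degenerate ⊤≡⊥ _ _)
    ... | no  ⊤≢⊥ = 
      let r , r∈ , eq = find (listing-complete s)
      in contradiction (trans (sym p) (take-⊥ width)) (encode-≢⊥ _⪯?_ ⊤≢⊥ {s = s} r∈ (S.⊑-reflexive eq))

    γ⟨f⟩ : MonotoneMap (values ^ (width + m)) (values ^ (width + n))
    γ⟨f⟩ = record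
      { apply    = γ[f].completion
      ; monotone = γ[f].completion-monotone encodedTransition-monotone
      ; strict   = γ[f].completion-strict encodedTransition-strict
      }

    synthesise : Completeness I → SCirc Sg m n
    synthesise C = Tr width ((reg (γ initial) ⊗ id m) ⨾ ‖ γ⟨f⟩ ‖)
      where open Completeness C

{-# OPTIONS --safe #-}
-- The register prefixes its input with the given word, so around the feedback
-- loop it carries the encoded state: if it emits γ(sᵢ) at time i, then the
-- completion of the encoded transition returns γ(sᵢ₊₁), which the register
-- emits at time i + 1. This determines every fixed point of the loop.
module Submission where

open import Level using (0ℓ)
open import Data.Nat.Base using (ℕ; zero; suc; _+_)
import Data.Nat.Properties as ℕ
open import Data.Product.Base using (_,_; proj₁; proj₂)
open import Data.Vec.Base as Vec using (Vec; []; _∷_; _++_; take; drop)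
import Data.Vec.Properties as Vec
open import Function.Base using (_∘_)
open import Relation.Binary.Core using (Rel)
open import Relation.Binary.Lattice.Bundles using (BoundedLattice)
import Relation.Binary.Lattice.Properties.BoundedJoinSemilattice as BoundedJoinSemilattice
open import Relation.Binary.Structures using (IsTotalOrder)
open import Relation.Binary.PropositionalEquality
  using (_≡_; refl; sym; trans; cong; cong₂; module ≡-Reasoning)
open import Relation.Nullary using (yes; no)
open import Defs

module _ {A : Set} where

  take-++ : ∀ {m n} (xs : Vec A m) (ys : Vec A n) → take m (xs ++ ys) ≡ xs
  take-++ []       ys = refl
  take-++ (x ∷ xs) ys = cong (x ∷_) (take-++ xs ys)

  drop-++ : ∀ {m n} (xs : Vec A m) (ys : Vec A n) → drop m (xs ++ ys) ≡ ys
  drop-++ []       ys = refl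
  drop-++ (x ∷ xs) ys = drop-++ xs ys

  -- The `coe` inside `unzip` denotes this cast. Regrouping isolates `y` as the single wire that
  -- `swap a 1` then moves past `xs`.
  ++-∷-uncast : ∀ {a b} (xs : Vec A a) y (ys : Vec A b) →
                Vec.cast (sym (ℕ.+-assoc a 1 b)) (xs ++ (y ∷ ys)) ≡ (xs ++ y ∷ []) ++ ys
  ++-∷-uncast {a} {b} xs y ys =
    Vec.cast-sym (ℕ.+-assoc a 1 b) (Vec.++-assoc-eqFree xs (y ∷ []) ys)

module _ {Sg : Signature} (I : Interpretation Sg) where
  open Signature Sg
  open Interpretation I using (values)
  open FiniteLattice

  private
    module ⊔-Properties n =
      BoundedJoinSemilattice (BoundedLattice.boundedJoinSemilattice (boundedLattice (values ^ n)))

  -- Stands in for function extensionality: by causality an output entry depends only on the entries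
  -- of the input, not on the function presenting them.
  ⟦⟧-ext : ∀ {m n} (F : SCirc Sg m n) {σ τ} → (∀ i → σ i ≡ τ i) → ∀ i → ⟦_⟧ I F σ i ≡ ⟦_⟧ I F τ i
  ⟦⟧-ext F σ≗τ i = StreamFunction.causal (denotation I F) i λ j _ → σ≗τ j

  ⟦coe⟧ : ∀ {m n} (eq : m ≡ n) σ i → ⟦_⟧ I (coe eq) σ i ≡ Vec.cast eq (σ i)
  ⟦coe⟧ refl σ i = sym (Vec.cast-is-id refl (σ i))

  -- Wiring acts at each time separately, so the shape of `σ` is needed only at the one time `i`.
  ⟦unzip⟧ : ∀ {a b} σ i x (xs : Vec V a) y (ys : Vec V b) → σ i ≡ (x ∷ xs) ++ (y ∷ ys) →
            ⟦_⟧ I (unzip a b) σ i ≡ x ∷ y ∷ xs ++ ys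
  ⟦unzip⟧ {a} {b} σ i x xs y ys eq = cong₂ _++_ {x = take 1 (σ i)} (cong (take 1) eq)
    (begin
      ⟦_⟧ I (swap a 1 ⊗ id b) ρ i
        ≡⟨ cong (λ zs → (drop a (take (a + 1) zs) ++ take a (take (a + 1) zs)) ++ drop (a + 1) zs) ρ-is ⟩
      (drop a (take (a + 1) ((xs ++ y ∷ []) ++ ys)) ++ take a (take (a + 1) ((xs ++ y ∷ []) ++ ys))) ++
      drop (a + 1) ((xs ++ y ∷ []) ++ ys)
        ≡⟨ cong₂ (λ zs ws → (drop a zs ++ take a zs) ++ ws)
             (take-++ (xs ++ y ∷ []) ys) (drop-++ (xs ++ y ∷ []) ys) ⟩
      (drop a (xs ++ y ∷ []) ++ take a (xs ++ y ∷ [])) ++ ys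
        ≡⟨ cong₂ (λ zs ws → (zs ++ ws) ++ ys) (drop-++ xs (y ∷ [])) (take-++ xs (y ∷ [])) ⟩
      y ∷ xs ++ ys ∎)
    where
    open ≡-Reasoning

    ρ : Stream (Vec V ((a + 1) + b))
    ρ = ⟦_⟧ I (coe (sym (ℕ.+-assoc a 1 b))) (drop 1 ∘ σ)

    ρ-is : ρ i ≡ (xs ++ y ∷ []) ++ ys
    ρ-is = begin
      ρ i
        ≡⟨ ⟦coe⟧ (sym (ℕ.+-assoc a 1 b)) (drop 1 ∘ σ) i ⟩
      Vec.cast _ (drop 1 (σ i))
        ≡⟨ cong (λ zs → Vec.cast (sym (ℕ.+-assoc a 1 b)) (drop 1 zs)) eq ⟩
      Vec.cast _ (xs ++ (y ∷ ys))
        ≡⟨ ++-∷-uncast xs y ys ⟩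
      (xs ++ y ∷ []) ++ ys ∎

  ⟦join⟧ : ∀ {n} σ i (xs ys : Vec V n) → σ i ≡ xs ++ ys →
           ⟦_⟧ I join[ n ] σ i ≡ _⊔_ (values ^ n) xs ys
  ⟦join⟧ σ i []       []       eq = eq
  ⟦join⟧ {suc n} σ i (x ∷ xs) (y ∷ ys) eq =
    -- `gen join` acts entrywise, so at time `i` a constant stream may replace its input.
    cong₂ _++_ (cong (λ zs → ⟦_⟧ I (gen join) (λ _ → take 2 zs) i) unzipped)
               (⟦join⟧ (drop 2 ∘ ⟦_⟧ I (unzip n n) σ) i xs ys (cong (drop 2) unzipped))
    where
    unzipped : ⟦_⟧ I (unzip n n) σ i ≡ x ∷ y ∷ xs ++ ys
    unzipped = ⟦unzip⟧ σ i x xs y ys eq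

  ⟦emit⟧ : ∀ v σ i → ⟦_⟧ I (emit v) σ i ≡ initially I v i
  ⟦emit⟧ v σ i with v ≟ⱽ •
  -- The constant stream emitted by `blank` is `initially I •`, but `initially` computes only once
  -- the time is split.
  ⟦emit⟧ v σ zero    | yes refl = refl
  ⟦emit⟧ v σ (suc i) | yes refl = refl
  ⟦emit⟧ v σ i       | no  _    = refl

  ⟦word⟧-zero : ∀ {n} (vs : Vec V n) σ → ⟦_⟧ I (word vs) σ 0 ≡ vs
  ⟦word⟧-zero []       σ with [] ← σ 0 = refl
  ⟦word⟧-zero (v ∷ vs) σ = cong₂ _++_ (⟦emit⟧ v _ 0) (⟦word⟧-zero vs _)

  ⟦word⟧-suc : ∀ {n} (vs : Vec V n) σ i → ⟦_⟧ I (word vs) σ (suc i) ≡ ⊥ (values ^ n)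
  ⟦word⟧-suc []       σ i with [] ← σ (suc i) = refl
  ⟦word⟧-suc (v ∷ vs) σ i = cong₂ _++_ (⟦emit⟧ v _ (suc i)) (⟦word⟧-suc vs _ i)

  ⟦delay⟧-zero : ∀ n σ → ⟦_⟧ I delay[ n ] σ 0 ≡ ⊥ (values ^ n)
  ⟦delay⟧-zero zero    σ with [] ← σ 0 = refl
  ⟦delay⟧-zero (suc n) σ = cong (• ∷_) (⟦delay⟧-zero n _)

  ⟦delay⟧-suc : ∀ n σ i → ⟦_⟧ I delay[ n ] σ (suc i) ≡ σ i
  ⟦delay⟧-suc zero    σ i with [] ← σ (suc i) | [] ← σ i = refl
  ⟦delay⟧-suc (suc n) σ i =
    trans (cong (take 1 (σ i) ++_) (⟦delay⟧-suc n _ i)) (Vec.take++drop≡id 1 (σ i))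

  -- At time 0 the delay emits only `⊥`, the unit of the join, so the word passes unchanged.
  ⟦reg⟧-zero : ∀ {n} (vs : Vec V n) σ → ⟦_⟧ I (reg vs) σ 0 ≡ vs
  ⟦reg⟧-zero {n} vs σ = trans
    (⟦join⟧ _ 0 vs (⊥ (values ^ n)) (cong₂ _++_ (⟦word⟧-zero vs _) (⟦delay⟧-zero n σ)))
    (⊔-Properties.identityʳ n vs)

  -- After time 0 it is the word that emits `⊥`, which leaves the delayed input.
  ⟦reg⟧-suc : ∀ {n} (vs : Vec V n) σ i → ⟦_⟧ I (reg vs) σ (suc i) ≡ σ i
  ⟦reg⟧-suc {n} vs σ i = trans
    (⟦join⟧ _ (suc i) (⊥ (values ^ n)) (σ i) (cong₂ _++_ (⟦word⟧-suc vs _ i) (⟦delay⟧-suc n σ i)))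
    (⊔-Properties.identityˡ n (σ i))

module _ {Sg : Signature} (I : Interpretation Sg) {m n : ℕ} (M : MealyMachine I m n)
         {_≤_ : Rel (Signature.V Sg) 0ℓ} (≤-total : IsTotalOrder _≡_ _≤_) where
  open Interpretation I using (values)
  open MealyMachine M
  open Accessibility M

  private
    k : ℕ
    k = width I M ≤-total

    γˢ : AccessibleState → ∣ values ^ k ∣
    γˢ = γ I M ≤-total

  -- Monotonicity of the encoded transition makes its completion extend it, whichever state is
  -- chosen as witness for a code. This covers the case `⊤ ≡ ⊥`, where all codes coincide.
  γ⟨f⟩-encoded : ∀ s x → MonotoneMap.apply (γ⟨f⟩ I M ≤-total) (γˢ s ++ x)
                         ≡ γˢ (next s x) ++ f₁ (proj₁ s) x
  γ⟨f⟩-encoded s x = trans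
    (γ[f].completion-∈ I M ≤-total (encodedTransition-monotone I M ≤-total)
      (γˢ s ++ x) (s , take-++ (γˢ s) x))
    (cong (λ y → γˢ (next s y) ++ f₁ (proj₁ s) y) (drop-++ (γˢ s) x))

  -- The run of the machine with accessibility proofs attached, since `γˢ` and `next` act on
  -- accessible states only.
  runᴬ : Stream ∣ values ^ m ∣ → Stream AccessibleState
  runᴬ σ zero    = initial
  runᴬ σ (suc i) = next (runᴬ σ i) (σ i)

  runᴬ-stateAt : ∀ σ i → proj₁ (runᴬ σ i) ≡ stateAt σ i
  runᴬ-stateAt σ zero    = refl
  runᴬ-stateAt σ (suc i) = cong (λ s → f₀ s (σ i)) (runᴬ-stateAt σ i)

  module _ (C : Completeness I) (σ : Stream ∣ values ^ m ∣) where
    open Completeness C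

    private
      body : SCirc Sg (k + m) (k + n)
      body = (reg (γˢ initial) ⊗ id m) ⨾ ‖ γ⟨f⟩ I M ≤-total ‖

      μ : Stream ∣ values ^ k ∣
      μ = leastFeedback I k (denotation I body) σ

      -- The wires leaving the register carry the code of the current state; `μ`, which enters it,
      -- carries that of the next.
      stored : Stream ∣ values ^ k ∣
      stored = ⟦_⟧ I (reg (γˢ initial)) μ

      body-output : ∀ i → ⟦_⟧ I body (λ j → μ j ++ σ j) i
                          ≡ MonotoneMap.apply (γ⟨f⟩ I M ≤-total) (stored i ++ σ i)
      body-output i = trans
        (‖‖-denotation (γ⟨f⟩ I M ≤-total) _ i)
        (cong (MonotoneMap.apply (γ⟨f⟩ I M ≤-total)) (cong₂ _++_
          -- The register reads past entries, so its input is rewritten at every time `j`, whereas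
          -- `id m` needs only time `i`.
          (⟦⟧-ext I (reg (γˢ initial)) (λ j → take-++ (μ j) (σ j)) i)
          (drop-++ (μ i) (σ i))))

      -- The left block feeds the induction on time, the right block is the output of the machine.
      body-encoded : ∀ i s → stored i ≡ γˢ s →
                     ⟦_⟧ I body (λ j → μ j ++ σ j) i ≡ γˢ (next s (σ i)) ++ f₁ (proj₁ s) (σ i)
      body-encoded i s eq = trans (body-output i)
        (trans (cong (λ v → MonotoneMap.apply (γ⟨f⟩ I M ≤-total) (v ++ σ i)) eq) (γ⟨f⟩-encoded s (σ i)))

      stored-encodes : ∀ i → stored i ≡ γˢ (runᴬ σ i)
      stored-encodes zero    = ⟦reg⟧-zero I (γˢ initial) μ
      stored-encodes (suc i) = begin
        stored (suc i)
          ≡⟨ ⟦reg⟧-suc I (γˢ initial) μ i ⟩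
        μ i
          -- The delay has lowered the time to `i`, so unfolding the fixed point once reaches the
          -- induction hypothesis.
          ≡⟨ proj₁ (leastFeedback-isLeastFixedPoint I k (denotation I body) σ) i ⟨
        take k (⟦_⟧ I body (λ j → μ j ++ σ j) i)
          ≡⟨ cong (take k) (body-encoded i (runᴬ σ i) (stored-encodes i)) ⟩
        take k (γˢ (runᴬ σ (suc i)) ++ f₁ (proj₁ (runᴬ σ i)) (σ i))
          ≡⟨ take-++ (γˢ (runᴬ σ (suc i))) _ ⟩
        γˢ (runᴬ σ (suc i)) ∎
        where open ≡-Reasoning

    !≡⟦synthesise⟧ : ∀ i → (! σ) i ≡ ⟦_⟧ I (synthesise I M ≤-total C) σ i
    !≡⟦synthesise⟧ i = sym (begin
      drop k (⟦_⟧ I body (λ j → μ j ++ σ j) i)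
        ≡⟨ cong (drop k) (body-encoded i (runᴬ σ i) (stored-encodes i)) ⟩
      drop k (γˢ (runᴬ σ (suc i)) ++ f₁ (proj₁ (runᴬ σ i)) (σ i))
        ≡⟨ drop-++ (γˢ (runᴬ σ (suc i))) _ ⟩
      f₁ (proj₁ (runᴬ σ i)) (σ i)
        ≡⟨ cong (λ s → f₁ s (σ i)) (runᴬ-stateAt σ i) ⟩
      (! σ) i ∎)
      where open ≡-Reasoning

theorem3p80 : (Sg : Signature) (I : Interpretation Sg) (C : Completeness I)
    (_≤_ : Rel (Signature.V Sg) 0ℓ) (≤-total : IsTotalOrder _≡_ _≤_)
    (m n : ℕ) (M : MealyMachine I m n) →
    ∀ σ i → MealyMachine.!_ M σ i ≡ ⟦_⟧ I (synthesise I M ≤-total C) σ i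
theorem3p80 Sg I C _≤_ ≤-total m n M σ i = !≡⟦synthesise⟧ I M ≤-total C σ i
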